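{- Let $A=\{(\alpha,\beta)\in\mathbb R^2:(\beta-1)^2+4\alpha\beta\ge0,\ \beta<0,\ \alpha\le2\}$ and $\widetilde A=\{(\alpha,\beta)\in\mathbb R^2:\beta>0,\ \alpha\ge1\}$. If $(\alpha,\beta)\in A$, then for every $n\ge1$ the polynomial $P_n^{(\alpha,\beta)}$ has only real zeros. If $(\alpha,\beta)\in\widetilde A$, then for every integer $n$ with $1\le n\le\lceil\alpha\rceil$ the polynomial $P_n^{(\alpha,\beta)}$ has only real zeros, where $\lceil\alpha\rceil$ is the smallest integer $\ge\alpha$.
   Context: For real $\alpha,\beta$ with $\beta\neq0$, the polynomials $P_n^{(\alpha,\beta)}(x)$, $n\ge0$, are defined by $\sum_{n\ge0}P_n^{(\alpha,\beta)}(x)\frac{t^n}{n!}=(1-t)^{\alpha}\exp\big(x((1-t)^{\beta}-1)\big)$ (formal power series in $t$). A polynomial "has only real zeros" if all its complex zeros are real. -}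

module Defs where

open import Data.Integer as ℤ using (ℤ; +_)
open import Data.List using (List; []; _∷_; map)
open import Data.Nat as ℕ using (ℕ; zero; suc; _!; _⊔_)
open import Data.Nat.Properties using (m⊔n≤o⇒m≤o; m⊔n≤o⇒n≤o; ≤-refl; _!≢0)
open import Data.Product using (∃; _×_; _,_)
open import Data.Rational as ℚ using (ℚ; 0ℚ; 1ℚ; ½)
import Data.Rational.Properties as ℚₚ
open import Data.Rational.Solver using (module +-*-Solver)
open import Relation.Binary.PropositionalEquality using (_≡_; refl; sym; trans; cong; subst)

-- Reals are Cauchy sequences of rationals; their equality is _≃_, not _≡_.

Eventually : (ℕ → Set) → Set
Eventually P = ∃ λ N → ∀ n → N ℕ.≤ n → P n

IsCauchy : (ℕ → ℚ) → Set
IsCauchy s = ∀ ε → 0ℚ ℚ.< ε →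
  ∃ λ N → ∀ m n → N ℕ.≤ m → N ℕ.≤ n → ℚ.∣ s m ℚ.- s n ∣ ℚ.< ε

record ℝ : Set where
  constructor mkℝ
  field
    seq    : ℕ → ℚ
    cauchy : IsCauchy seq

open ℝ public

infix 4 _≃_ _≤ℝ_ _<ℝ_

record _≃_ (x y : ℝ) : Set where
  constructor mk≃
  field
    close : ∀ ε → 0ℚ ℚ.< ε → Eventually λ n → ℚ.∣ seq x n ℚ.- seq y n ∣ ℚ.< ε

record _≤ℝ_ (x y : ℝ) : Set where
  constructor mk≤
  field
    almostBelow : ∀ ε → 0ℚ ℚ.< ε → Eventually λ n → seq x n ℚ.< seq y n ℚ.+ ε

record _<ℝ_ (x y : ℝ) : Set where
  constructor mk<
  field
    gap      : ℚ
    gap-pos  : 0ℚ ℚ.< gap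
    gapBelow : Eventually λ n → seq x n ℚ.+ gap ℚ.< seq y n

open _≃_ public
open _≤ℝ_ public
open _<ℝ_ public

module CauchyProperties where
  halve : ∀ ε → ε ℚ.* ½ ℚ.+ ε ℚ.* ½ ≡ ε
  halve ε = trans (sym (ℚₚ.*-distribˡ-+ ε ½ ½)) (ℚₚ.*-identityʳ ε)

  half-pos : ∀ {ε} → 0ℚ ℚ.< ε → 0ℚ ℚ.< ε ℚ.* ½
  half-pos {ε} 0<ε =
    ℚₚ.positive⁻¹ (ε ℚ.* ½) {{ℚₚ.pos*pos⇒pos ε {{ℚ.positive 0<ε}} ½}}

  const-cauchy : ∀ q → IsCauchy (λ _ → q)
  const-cauchy q ε 0<ε =
    0 , λ _ _ _ _ → subst (λ r → ℚ.∣ r ∣ ℚ.< ε) (sym (ℚₚ.+-inverseʳ q)) 0<ε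

  neg-cauchy : ∀ {s} → IsCauchy s → IsCauchy (λ n → ℚ.- s n)
  neg-cauchy {s} cs ε 0<ε with cs ε 0<ε
  ... | N , h = N , λ m n N≤m N≤n →
    subst (ℚ._< ε)
      (trans (sym (ℚₚ.∣-p∣≡∣p∣ (s m ℚ.- s n))) (cong ℚ.∣_∣ (rearrange (s m) (s n))))
      (h m n N≤m N≤n)
    where
    open +-*-Solver
    rearrange : ∀ a b → ℚ.- (a ℚ.- b) ≡ ℚ.- a ℚ.- (ℚ.- b)
    rearrange = solve 2 (λ a b → :- (a :- b) := :- a :- (:- b)) refl

  +-cauchy : ∀ {s t} → IsCauchy s → IsCauchy t → IsCauchy (λ n → s n ℚ.+ t n)
  +-cauchy {s} {t} cs ct ε 0<ε
    with cs (ε ℚ.* ½) (half-pos 0<ε) | ct (ε ℚ.* ½) (half-pos 0<ε)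
  ... | M , f | N , g = M ⊔ N , λ m n p q → begin-strict
    ℚ.∣ (s m ℚ.+ t m) ℚ.- (s n ℚ.+ t n) ∣
      ≡⟨ cong ℚ.∣_∣ (rearrange (s m) (t m) (s n) (t n)) ⟩
    ℚ.∣ (s m ℚ.- s n) ℚ.+ (t m ℚ.- t n) ∣
      ≤⟨ ℚₚ.∣p+q∣≤∣p∣+∣q∣ (s m ℚ.- s n) (t m ℚ.- t n) ⟩
    ℚ.∣ s m ℚ.- s n ∣ ℚ.+ ℚ.∣ t m ℚ.- t n ∣
      <⟨ ℚₚ.+-mono-< (f m n (m⊔n≤o⇒m≤o M N p) (m⊔n≤o⇒m≤o M N q))
                     (g m n (m⊔n≤o⇒n≤o M N p) (m⊔n≤o⇒n≤o M N q)) ⟩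
    ε ℚ.* ½ ℚ.+ ε ℚ.* ½
      ≡⟨ halve ε ⟩
    ε ∎
    where
    open ℚₚ.≤-Reasoning
    open +-*-Solver
    rearrange : ∀ a b c d → (a ℚ.+ b) ℚ.- (c ℚ.+ d) ≡ (a ℚ.- c) ℚ.+ (b ℚ.- d)
    rearrange = solve 4 (λ a b c d → (a :+ b) :- (c :+ d) := (a :- c) :+ (b :- d)) refl

  eventually-bounded : ∀ {s} → IsCauchy s →
    ∃ λ B → ℚ.Positive B × Eventually λ n → ℚ.∣ s n ∣ ℚ.≤ B
  eventually-bounded {s} cs with cs 1ℚ (ℚₚ.positive⁻¹ 1ℚ)
  ... | N , h = 1ℚ ℚ.+ ℚ.∣ s N ∣
              , ℚₚ.pos+nonNeg⇒pos 1ℚ ℚ.∣ s N ∣ {{ℚₚ.∣-∣-nonNeg (s N)}}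
              , N , λ n N≤n → begin
    ℚ.∣ s n ∣                             ≡⟨ cong ℚ.∣_∣ (rearrange (s n) (s N)) ⟩
    ℚ.∣ (s n ℚ.- s N) ℚ.+ s N ∣           ≤⟨ ℚₚ.∣p+q∣≤∣p∣+∣q∣ (s n ℚ.- s N) (s N) ⟩
    ℚ.∣ s n ℚ.- s N ∣ ℚ.+ ℚ.∣ s N ∣       ≤⟨ ℚₚ.+-monoˡ-≤ ℚ.∣ s N ∣ (ℚₚ.<⇒≤ (h n N N≤n ≤-refl)) ⟩
    1ℚ ℚ.+ ℚ.∣ s N ∣                      ∎
    where
    open ℚₚ.≤-Reasoning
    open +-*-Solver
    rearrange : ∀ a b → a ≡ (a ℚ.- b) ℚ.+ b
    rearrange = solve 2 (λ a b → a := (a :- b) :+ b) refl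

  shrink : ∀ {δ} → 0ℚ ℚ.< δ → ∀ B → ℚ.Positive B →
    ∃ λ η → 0ℚ ℚ.< η × (∀ a b → ℚ.∣ a ∣ ℚ.≤ B → ℚ.∣ b ∣ ℚ.< η → ℚ.∣ a ℚ.* b ∣ ℚ.< δ)
  shrink {δ} 0<δ B B>0 = η , 0<η , λ a b a≤B b<η → begin-strict
    ℚ.∣ a ℚ.* b ∣        ≡⟨ ℚₚ.∣p*q∣≡∣p∣*∣q∣ a b ⟩
    ℚ.∣ a ∣ ℚ.* ℚ.∣ b ∣  ≤⟨ ℚₚ.*-monoʳ-≤-nonNeg ℚ.∣ b ∣ {{ℚₚ.∣-∣-nonNeg b}} a≤B ⟩
    B ℚ.* ℚ.∣ b ∣        <⟨ ℚₚ.*-monoʳ-<-pos B b<η ⟩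
    B ℚ.* η              ≡⟨ ℚₚ.*-assoc B (ℚ.1/ B) δ ⟨
    B ℚ.* ℚ.1/ B ℚ.* δ   ≡⟨ cong (ℚ._* δ) (ℚₚ.*-inverseʳ B) ⟩
    1ℚ ℚ.* δ             ≡⟨ ℚₚ.*-identityˡ δ ⟩
    δ                    ∎
    where
    open ℚₚ.≤-Reasoning
    instance
      _ = B>0
      _ = ℚₚ.pos⇒nonZero B
      _ = ℚ.positive 0<δ
    η : ℚ
    η = ℚ.1/ B ℚ.* δ
    0<η : 0ℚ ℚ.< η
    0<η = ℚₚ.positive⁻¹ η {{ℚₚ.pos*pos⇒pos (ℚ.1/ B) {{ℚₚ.1/pos⇒pos B}} δ}}

  *-cauchy : ∀ {s t} → IsCauchy s → IsCauchy t → IsCauchy (λ n → s n ℚ.* t n)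
  *-cauchy {s} {t} cs ct ε 0<ε =
    let B , B>0 , K , s≤B = eventually-bounded cs
        C , C>0 , L , t≤C = eventually-bounded ct
        η , 0<η , smallˢ  = shrink (half-pos 0<ε) B B>0
        θ , 0<θ , smallᵗ  = shrink (half-pos 0<ε) C C>0
        M , f             = ct η 0<η
        N , g             = cs θ 0<θ
    in (K ⊔ L) ⊔ (M ⊔ N) , λ m n p q →
      let K≤m = m⊔n≤o⇒m≤o K L (m⊔n≤o⇒m≤o (K ⊔ L) (M ⊔ N) p)
          L≤n = m⊔n≤o⇒n≤o K L (m⊔n≤o⇒m≤o (K ⊔ L) (M ⊔ N) q)
          M≤m = m⊔n≤o⇒m≤o M N (m⊔n≤o⇒n≤o (K ⊔ L) (M ⊔ N) p)
          M≤n = m⊔n≤o⇒m≤o M N (m⊔n≤o⇒n≤o (K ⊔ L) (M ⊔ N) q)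
          N≤m = m⊔n≤o⇒n≤o M N (m⊔n≤o⇒n≤o (K ⊔ L) (M ⊔ N) p)
          N≤n = m⊔n≤o⇒n≤o M N (m⊔n≤o⇒n≤o (K ⊔ L) (M ⊔ N) q)
      in begin-strict
        ℚ.∣ s m ℚ.* t m ℚ.- s n ℚ.* t n ∣
          ≡⟨ cong ℚ.∣_∣ (rearrange (s m) (t m) (s n) (t n)) ⟩
        ℚ.∣ s m ℚ.* (t m ℚ.- t n) ℚ.+ t n ℚ.* (s m ℚ.- s n) ∣
          ≤⟨ ℚₚ.∣p+q∣≤∣p∣+∣q∣ (s m ℚ.* (t m ℚ.- t n)) (t n ℚ.* (s m ℚ.- s n)) ⟩
        ℚ.∣ s m ℚ.* (t m ℚ.- t n) ∣ ℚ.+ ℚ.∣ t n ℚ.* (s m ℚ.- s n) ∣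
          <⟨ ℚₚ.+-mono-< (smallˢ (s m) (t m ℚ.- t n) (s≤B m K≤m) (f m n M≤m M≤n))
                         (smallᵗ (t n) (s m ℚ.- s n) (t≤C n L≤n) (g m n N≤m N≤n)) ⟩
        ε ℚ.* ½ ℚ.+ ε ℚ.* ½
          ≡⟨ halve ε ⟩
        ε ∎
    where
    open ℚₚ.≤-Reasoning
    open +-*-Solver
    rearrange : ∀ a b c d →
      a ℚ.* b ℚ.- c ℚ.* d ≡ a ℚ.* (b ℚ.- d) ℚ.+ d ℚ.* (a ℚ.- c)
    rearrange = solve 4 (λ a b c d →
      a :* b :- c :* d := a :* (b :- d) :+ d :* (a :- c)) refl

open CauchyProperties

infixl 6 _+ℝ_ _-ℝ_
infixl 7 _*ℝ_
infix  8 -ℝ_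

fromℚ : ℚ → ℝ
fromℚ q = mkℝ (λ _ → q) (const-cauchy q)

fromℤ : ℤ → ℝ
fromℤ k = fromℚ (k ℚ./ 1)

fromℕ : ℕ → ℝ
fromℕ n = fromℤ (+ n)

0ℝ 1ℝ : ℝ
0ℝ = fromℚ 0ℚ
1ℝ = fromℚ 1ℚ

_+ℝ_ _*ℝ_ : ℝ → ℝ → ℝ
mkℝ s cs +ℝ mkℝ t ct = mkℝ (λ n → s n ℚ.+ t n) (+-cauchy {s} {t} cs ct)
mkℝ s cs *ℝ mkℝ t ct = mkℝ (λ n → s n ℚ.* t n) (*-cauchy {s} {t} cs ct)

-ℝ_ : ℝ → ℝ
-ℝ mkℝ s cs = mkℝ (λ n → ℚ.- s n) (neg-cauchy {s} cs)

_-ℝ_ : ℝ → ℝ → ℝ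
x -ℝ y = x +ℝ (-ℝ y)

-- The ceiling is a relation because it is not computable on Cauchy reals.
IsCeiling : ℝ → ℤ → Set
IsCeiling x k = x ≤ℝ fromℤ k × (∀ m → x ≤ℝ fromℤ m → k ℤ.≤ m)

record ℂ : Set where
  constructor _+i_
  field
    re : ℝ
    im : ℝ

open ℂ public

infix 4 _≃ℂ_

_≃ℂ_ : ℂ → ℂ → Set
z ≃ℂ w = re z ≃ re w × im z ≃ im w

ofReal : ℝ → ℂ
ofReal x = x +i 0ℝ

0ℂ : ℂ
0ℂ = ofReal 0ℝ

infixl 6 _+ℂ_
infixl 7 _*ℂ_

_+ℂ_ _*ℂ_ : ℂ → ℂ → ℂ
z +ℂ w = (re z +ℝ re w) +i (im z +ℝ im w)
z *ℂ w = (re z *ℝ re w -ℝ im z *ℝ im w) +i (re z *ℝ im w +ℝ im z *ℝ re w)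

-- Coefficients in ℝ[x], constant term first; trailing zeros are allowed.
Poly : Set
Poly = List ℝ

infixl 6 _+ₚ_
infixl 7 _*ₚ_ _·ₚ_

constₚ : ℝ → Poly
constₚ c = c ∷ []

X : Poly
X = 0ℝ ∷ 1ℝ ∷ []

_+ₚ_ : Poly → Poly → Poly
[]      +ₚ q       = q
(a ∷ p) +ₚ []      = a ∷ p
(a ∷ p) +ₚ (b ∷ q) = (a +ℝ b) ∷ (p +ₚ q)

_·ₚ_ : ℝ → Poly → Poly
c ·ₚ p = map (c *ℝ_) p

_*ₚ_ : Poly → Poly → Poly
[]      *ₚ q = []
(a ∷ p) *ₚ q = (a ·ₚ q) +ₚ (0ℝ ∷ (p *ₚ q))

evalℂ : Poly → ℂ → ℂ
evalℂ []      z = 0ℂ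
evalℂ (a ∷ p) z = ofReal a +ℂ z *ℂ evalℂ p z

HasOnlyRealZeros : Poly → Set
HasOnlyRealZeros p = ∀ z → evalℂ p z ≃ℂ 0ℂ → im z ≃ 0ℝ

-- ℝ[x][[t]]: the n-th entry is the coefficient of tⁿ.
Series : Set
Series = ℕ → Poly

∑≤ : ℕ → (ℕ → Poly) → Poly
∑≤ zero    f = f 0
∑≤ (suc n) f = ∑≤ n f +ₚ f (suc n)

infixl 6 _-ₛ_
infixl 7 _*ₛ_ _·ₛ_
infixr 8 _^ₛ_

1ₛ : Series
1ₛ zero    = constₚ 1ℝ
1ₛ (suc _) = []

_-ₛ_ : Series → Series → Series
(f -ₛ g) n = f n +ₚ ((-ℝ 1ℝ) ·ₚ g n)

_*ₛ_ : Series → Series → Series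
(f *ₛ g) n = ∑≤ n λ k → f k *ₚ g (n ℕ.∸ k)

_·ₛ_ : Poly → Series → Series
(p ·ₛ f) n = p *ₚ f n

_^ₛ_ : Series → ℕ → Series
f ^ₛ zero  = 1ₛ
f ^ₛ suc k = f *ₛ (f ^ₛ k)

1/fact : ℕ → ℝ
1/fact k = fromℚ ((+ 1 ℚ./ (k !)) {{k !≢0}})

-- exp u = ∑ₖ uᵏ / k!, for u with zero constant term: then uᵏ does not
-- contribute to the coefficient of tⁿ when k > n.
expₛ : Series → Series
expₛ u n = ∑≤ n λ k → 1/fact k ·ₚ (u ^ₛ k) n

fallingFactorial : ℝ → ℕ → ℝ
fallingFactorial γ zero    = 1ℝ
fallingFactorial γ (suc k) = fallingFactorial γ k *ℝ (γ -ℝ fromℕ k)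

binomial : ℝ → ℕ → ℝ
binomial γ k = 1/fact k *ℝ fallingFactorial γ k

sign : ℕ → ℝ
sign zero    = 1ℝ
sign (suc k) = -ℝ sign k

-- (1 - t)^γ = ∑ₖ binomial γ k (- t)ᵏ
[1-t]^_ : ℝ → Series
([1-t]^ γ) k = constₚ (binomial γ k *ℝ sign k)

generatingFunction : ℝ → ℝ → Series
generatingFunction α β = ([1-t]^ α) *ₛ expₛ (X ·ₛ (([1-t]^ β) -ₛ 1ₛ))

-- ∑ₙ P α β n tⁿ / n! = generatingFunction α β
P : ℝ → ℝ → ℕ → Poly
P α β n = fromℕ (n !) ·ₚ generatingFunction α β n

A : ℝ → ℝ → Set
A α β = 0ℝ ≤ℝ (β -ℝ 1ℝ) *ℝ (β -ℝ 1ℝ) +ℝ fromℕ 4 *ℝ α *ℝ β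
      × β <ℝ 0ℝ
      × α ≤ℝ fromℕ 2

Ã : ℝ → ℝ → Set
Ã α β = 0ℝ <ℝ β × 1ℝ ≤ℝ α

{-# OPTIONS --safe #-}
module Submission where

-- The generating function satisfies (1 - t) F_t = - α F - β x (F_x + F), so that
-- P_{n+1} = (n - α - β x) P_n - β x P_n′. Put c = n - α and b = - β. Writing F for a
-- multi-affine polynomial in x₁, …, x_n whose diagonal is P_n, the polynomial
-- (c + b x) F + b x (∂₁ + … + ∂_n) F, with x a new variable, has diagonal P_{n+1}. If F does
-- not vanish when all variables are in the upper half-plane, then Im (∂ⱼF / F) ≤ 0 there,
-- because F is affine in xⱼ; so for c b ≥ 0 the quotient of the new polynomial by b x F,
-- c / (b x) + 1 + ∑ ∂ⱼF / F, has negative imaginary part and the new polynomial does not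
-- vanish either. The induction starts at P₁, and in the case β < 0, where c ≥ 0 only from
-- n = 2 on, at the symmetric polarisation of P₂, for which the condition on (α , β) says that
-- the discriminant is nonnegative. No root is ever computed, and since Im z ≃ 0 is stable
-- under double negation, classical case distinctions are harmless.

open import Defs
open CauchyProperties
open import Algebra.Bundles using (CommutativeRing; CommutativeSemiring)
import Algebra.Solver.Ring as RingSolver
open import Algebra.Solver.Ring.AlmostCommutativeRing using (AlmostCommutativeRing; fromCommutativeRing; _-Raw-AlmostCommutative⟶_)
import Algebra.Solver.Ring.NaturalCoefficients.Default as SemiringSolver
open import Data.Integer as ℤ using (ℤ; +_)
import Data.Integer.Properties as ℤₚ
open import Data.List using ([]; _∷_)
open import Data.Maybe using (Maybe; just; nothing)
open import Data.Nat as ℕ using (ℕ; zero; suc; _∸_; _!; _⊔_; z≤n; s≤s)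
import Data.Nat.Properties as ℕₚ
open import Data.Product using (∃; _×_; _,_; proj₁)
open import Data.Rational as ℚ using (ℚ; 0ℚ; 1ℚ; ½)
import Data.Rational.Properties as ℚₚ
open import Data.Rational.Solver using (module +-*-Solver)
open import Data.Rational.Unnormalised as ℚᵘ using (mkℚᵘ)
import Data.Rational.Unnormalised.Properties as ℚᵘₚ
open import Data.Sum using (_⊎_; inj₁; inj₂; [_,_]′)
open import Data.Vec using (Vec; []; _∷_; replicate)
open import Data.Vec.Relation.Unary.All using (All; []; _∷_)
open import Level using (0ℓ)
open import Relation.Binary.PropositionalEquality using (_≡_; refl; sym; trans; cong; cong₂; subst; subst₂)
import Relation.Binary.Reasoning.Setoid as SetoidReasoning
open import Relation.Nullary using (¬_; yes; no; contradiction)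

-- Over Cauchy reals a number that is not zero need not be known to be apart from zero, so the
-- quotients of the argument are never formed. The sign of Im (x / y) is read off `cross x y`, which
-- is |y|² times it, and the root - A / B of an affine polynomial is the pair (- A , B), available
-- before B is known to be nonzero. The step is delicate at c = 0, where c / (b x) contributes
-- nothing and the imaginary parts of ∂ⱼF / F are only known to be nonpositive. Strictness comes
-- from the first variable: for F = A + x₁ B the quotient ∂₁F / F = B / (A + x₁ B) has negative
-- imaginary part as soon as B ≠ 0. Hence the induction carries the stability of B along with that
-- of F. With c = n - α and b = - β, the condition c b ≥ 0 reads n ≥ α for β < 0 and n ≤ α for β >
-- 0, which is where the ceiling enters. A multi-affine polynomial matters only through its
-- diagonal, so the one that the step produces for P₂ may be exchanged for the symmetric one.

≤-<-connex : ∀ p q → p ℚ.≤ q ⊎ q ℚ.< p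
≤-<-connex p q with p ℚₚ.≤? q
... | yes p≤q = inj₁ p≤q
... | no  p≰q = inj₂ (ℚₚ.≰⇒> p≰q)

eventually-zip : ∀ {P Q R : ℕ → Set} → (∀ n → P n → Q n → R n) →
  Eventually P → Eventually Q → Eventually R
eventually-zip f (M , p) (N , q) = M ⊔ N , λ n h →
  f n (p n (ℕₚ.m⊔n≤o⇒m≤o M N h)) (q n (ℕₚ.m⊔n≤o⇒n≤o M N h))

eventually-map : ∀ {P Q : ℕ → Set} → (∀ n → P n → Q n) → Eventually P → Eventually Q
eventually-map f (M , p) = M , λ n h → f n (p n h)

module _ where
  open +-*-Solver
  open ℚₚ.≤-Reasoning

  p≤∣p∣ : ∀ p → p ℚ.≤ ℚ.∣ p ∣
  p≤∣p∣ p with ℚₚ.≤-total 0ℚ p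
  ... | inj₁ 0≤p = ℚₚ.≤-reflexive (sym (ℚₚ.0≤p⇒∣p∣≡p 0≤p))
  ... | inj₂ p≤0 = ℚₚ.≤-trans p≤0 (ℚₚ.0≤∣p∣ p)

  ∣-∣-swap : ∀ p q → ℚ.∣ p ℚ.- q ∣ ≡ ℚ.∣ q ℚ.- p ∣
  ∣-∣-swap p q = trans (sym (ℚₚ.∣-p∣≡∣p∣ (p ℚ.- q)))
    (cong ℚ.∣_∣ (solve 2 (λ a b → :- (a :- b) := b :- a) refl p q))

  ∣-∣<⇒< : ∀ p q {ε} → ℚ.∣ p ℚ.- q ∣ ℚ.< ε → p ℚ.< q ℚ.+ ε
  ∣-∣<⇒< p q {ε} d = begin-strict
    p                  ≡⟨ solve 2 (λ a b → a := b :+ (a :- b)) refl p q ⟩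
    q ℚ.+ (p ℚ.- q)    ≤⟨ ℚₚ.+-monoʳ-≤ q (p≤∣p∣ (p ℚ.- q)) ⟩
    q ℚ.+ ℚ.∣ p ℚ.- q ∣ <⟨ ℚₚ.+-monoʳ-< q d ⟩
    q ℚ.+ ε            ∎

  ∣-∣<⇒> : ∀ p q {ε} → ℚ.∣ p ℚ.- q ∣ ℚ.< ε → q ℚ.< p ℚ.+ ε
  ∣-∣<⇒> p q {ε} d = ∣-∣<⇒< q p (subst (ℚ._< ε) (∣-∣-swap p q) d)

  ∣-∣<-trans : ∀ p q r {ε} → ℚ.∣ p ℚ.- q ∣ ℚ.< ε ℚ.* ½ → ℚ.∣ q ℚ.- r ∣ ℚ.< ε ℚ.* ½ →
    ℚ.∣ p ℚ.- r ∣ ℚ.< ε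
  ∣-∣<-trans p q r {ε} d e = begin-strict
    ℚ.∣ p ℚ.- r ∣
      ≡⟨ cong ℚ.∣_∣ (solve 3 (λ a b c → a :- c := (a :- b) :+ (b :- c)) refl p q r) ⟩
    ℚ.∣ (p ℚ.- q) ℚ.+ (q ℚ.- r) ∣
      ≤⟨ ℚₚ.∣p+q∣≤∣p∣+∣q∣ (p ℚ.- q) (q ℚ.- r) ⟩
    ℚ.∣ p ℚ.- q ∣ ℚ.+ ℚ.∣ q ℚ.- r ∣
      <⟨ ℚₚ.+-mono-< d e ⟩
    ε ℚ.* ½ ℚ.+ ε ℚ.* ½
      ≡⟨ halve ε ⟩
    ε ∎

-- Equality and ring structure of the Cauchy reals

≃-pointwise : ∀ {x y} → (∀ n → seq x n ≡ seq y n) → x ≃ y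
≃-pointwise {x} {y} h = mk≃ λ ε 0<ε → 0 , λ n _ →
  subst (λ r → ℚ.∣ r ∣ ℚ.< ε)
    (sym (trans (cong (ℚ._- seq y n) (h n)) (ℚₚ.+-inverseʳ (seq y n)))) 0<ε

≃-refl : ∀ {x} → x ≃ x
≃-refl = ≃-pointwise λ _ → refl

≃-sym : ∀ {x y} → x ≃ y → y ≃ x
≃-sym {x} {y} h = mk≃ λ ε 0<ε →
  eventually-map (λ n → subst (ℚ._< ε) (∣-∣-swap (seq x n) (seq y n))) (close h ε 0<ε)

≃-trans : ∀ {x y z} → x ≃ y → y ≃ z → x ≃ z
≃-trans {x} {y} {z} h k = mk≃ λ ε 0<ε →
  eventually-zip (λ n → ∣-∣<-trans (seq x n) (seq y n) (seq z n))
    (close h (ε ℚ.* ½) (half-pos 0<ε)) (close k (ε ℚ.* ½) (half-pos 0<ε))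

-- Opaque: otherwise comparing nested sums and products unfolds their Cauchy moduli.
opaque
  infixl 6 _⊕_
  infixl 7 _⊗_
  infix  8 ⊖_

  _⊕_ _⊗_ : ℝ → ℝ → ℝ
  _⊕_ = _+ℝ_
  _⊗_ = _*ℝ_

  ⊖_ : ℝ → ℝ
  ⊖_ = -ℝ_

module _ where
  open +-*-Solver

  opaque
    unfolding _⊕_

    -- These three equations carry the operations of the statement over to their opaque copies; they
    -- hold by `refl` only where the copies are unfolded.
    +ℝ≡⊕ : ∀ x y → x +ℝ y ≡ x ⊕ y
    +ℝ≡⊕ _ _ = refl

    *ℝ≡⊗ : ∀ x y → x *ℝ y ≡ x ⊗ y
    *ℝ≡⊗ _ _ = refl

    -ℝ≡⊖ : ∀ x → -ℝ x ≡ ⊖ x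
    -ℝ≡⊖ _ = refl

    ⊖-cong : ∀ {x y} → x ≃ y → ⊖ x ≃ ⊖ y
    ⊖-cong {x} {y} h = mk≃ λ ε 0<ε → eventually-map
      (λ n → subst (ℚ._< ε) (trans (∣-∣-swap (seq x n) (seq y n)) (cong ℚ.∣_∣
        (solve 2 (λ a b → b :- a := :- a :- (:- b)) refl (seq x n) (seq y n)))))
      (close h ε 0<ε)

    ⊕-congʳ : ∀ x {y z} → y ≃ z → x ⊕ y ≃ x ⊕ z
    ⊕-congʳ x {y} {z} h = mk≃ λ ε 0<ε → eventually-map
      (λ n → subst (ℚ._< ε) (cong ℚ.∣_∣
        (solve 3 (λ a b c → b :- c := (a :+ b) :- (a :+ c)) refl (seq x n) (seq y n) (seq z n))))
      (close h ε 0<ε)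

    -- The sequence of `x` is eventually bounded, and `shrink` turns the bound into the tolerance to
    -- be asked of `y` and `z`.
    ⊗-congʳ : ∀ x {y z} → y ≃ z → x ⊗ y ≃ x ⊗ z
    ⊗-congʳ x {y} {z} h = mk≃ λ ε 0<ε →
      let B , B>0 , bounded = eventually-bounded {seq x} (cauchy x)
          η , 0<η , small   = shrink 0<ε B B>0
      in eventually-zip
        (λ n ∣x∣≤B d → subst (ℚ._< ε) (cong ℚ.∣_∣
          (solve 3 (λ a b c → a :* (b :- c) := a :* b :- a :* c) refl (seq x n) (seq y n) (seq z n)))
          (small (seq x n) (seq y n ℚ.- seq z n) ∣x∣≤B d))
        bounded (close h η 0<η)

    ⊕-comm : ∀ x y → x ⊕ y ≃ y ⊕ x
    ⊕-comm x y = ≃-pointwise λ n → ℚₚ.+-comm (seq x n) (seq y n)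

    ⊗-comm : ∀ x y → x ⊗ y ≃ y ⊗ x
    ⊗-comm x y = ≃-pointwise λ n → ℚₚ.*-comm (seq x n) (seq y n)

    ⊕-cong : ∀ {x y u v} → x ≃ y → u ≃ v → x ⊕ u ≃ y ⊕ v
    ⊕-cong {x} {y} {u} {v} h k =
      ≃-trans {x ⊕ u} {x ⊕ v} {y ⊕ v} (⊕-congʳ x {u} {v} k)
        (≃-trans {x ⊕ v} {v ⊕ x} {y ⊕ v} (⊕-comm x v)
          (≃-trans {v ⊕ x} {v ⊕ y} {y ⊕ v} (⊕-congʳ v {x} {y} h) (⊕-comm v y)))

    ⊗-cong : ∀ {x y u v} → x ≃ y → u ≃ v → x ⊗ u ≃ y ⊗ v
    ⊗-cong {x} {y} {u} {v} h k =
      ≃-trans {x ⊗ u} {x ⊗ v} {y ⊗ v} (⊗-congʳ x {u} {v} k)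
        (≃-trans {x ⊗ v} {v ⊗ x} {y ⊗ v} (⊗-comm x v)
          (≃-trans {v ⊗ x} {v ⊗ y} {y ⊗ v} (⊗-congʳ v {x} {y} h) (⊗-comm v y)))

    ⊕-assoc : ∀ x y z → (x ⊕ y) ⊕ z ≃ x ⊕ (y ⊕ z)
    ⊕-assoc x y z = ≃-pointwise λ n → ℚₚ.+-assoc (seq x n) (seq y n) (seq z n)

    ⊕-identityˡ : ∀ x → 0ℝ ⊕ x ≃ x
    ⊕-identityˡ x = ≃-pointwise λ n → ℚₚ.+-identityˡ (seq x n)

    ⊕-identityʳ : ∀ x → x ⊕ 0ℝ ≃ x
    ⊕-identityʳ x = ≃-pointwise λ n → ℚₚ.+-identityʳ (seq x n)

    ⊖-inverseˡ : ∀ x → ⊖ x ⊕ x ≃ 0ℝ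
    ⊖-inverseˡ x = ≃-pointwise λ n → ℚₚ.+-inverseˡ (seq x n)

    ⊖-inverseʳ : ∀ x → x ⊕ ⊖ x ≃ 0ℝ
    ⊖-inverseʳ x = ≃-pointwise λ n → ℚₚ.+-inverseʳ (seq x n)

    ⊗-assoc : ∀ x y z → (x ⊗ y) ⊗ z ≃ x ⊗ (y ⊗ z)
    ⊗-assoc x y z = ≃-pointwise λ n → ℚₚ.*-assoc (seq x n) (seq y n) (seq z n)

    ⊗-identityˡ : ∀ x → 1ℝ ⊗ x ≃ x
    ⊗-identityˡ x = ≃-pointwise λ n → ℚₚ.*-identityˡ (seq x n)

    ⊗-identityʳ : ∀ x → x ⊗ 1ℝ ≃ x
    ⊗-identityʳ x = ≃-pointwise λ n → ℚₚ.*-identityʳ (seq x n)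

    ⊗-distribˡ-⊕ : ∀ x y z → x ⊗ (y ⊕ z) ≃ x ⊗ y ⊕ x ⊗ z
    ⊗-distribˡ-⊕ x y z = ≃-pointwise λ n → ℚₚ.*-distribˡ-+ (seq x n) (seq y n) (seq z n)

    ⊗-distribʳ-⊕ : ∀ x y z → (y ⊕ z) ⊗ x ≃ y ⊗ x ⊕ z ⊗ x
    ⊗-distribʳ-⊕ x y z = ≃-pointwise λ n → ℚₚ.*-distribʳ-+ (seq x n) (seq y n) (seq z n)

    fromℚ-+ : ∀ p q → fromℚ (p ℚ.+ q) ≃ fromℚ p ⊕ fromℚ q
    fromℚ-+ _ _ = ≃-pointwise λ _ → refl

    fromℚ-* : ∀ p q → fromℚ (p ℚ.* q) ≃ fromℚ p ⊗ fromℚ q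
    fromℚ-* _ _ = ≃-pointwise λ _ → refl

    fromℚ-neg : ∀ p → fromℚ (ℚ.- p) ≃ ⊖ fromℚ p
    fromℚ-neg _ = ≃-pointwise λ _ → refl

ℝ-commutativeRing : CommutativeRing 0ℓ 0ℓ
ℝ-commutativeRing = record
  { Carrier = ℝ
  ; _≈_ = _≃_
  ; _+_ = _⊕_
  ; _*_ = _⊗_
  ; -_ = ⊖_
  ; 0# = 0ℝ
  ; 1# = 1ℝ
  ; isCommutativeRing = record
    { isRing = record
      { +-isAbelianGroup = record
        { isGroup = record
          { isMonoid = record
            { isSemigroup = record
              { isMagma = record
                { isEquivalence = record { refl = ≃-refl ; sym = ≃-sym ; trans = ≃-trans }
                ; ∙-cong = ⊕-cong
                }
              ; assoc = ⊕-assoc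
              }
            ; identity = ⊕-identityˡ , ⊕-identityʳ
            }
          ; inverse = ⊖-inverseˡ , ⊖-inverseʳ
          ; ⁻¹-cong = ⊖-cong
          }
        ; comm = ⊕-comm
        }
      ; *-cong = ⊗-cong
      ; *-assoc = ⊗-assoc
      ; *-identity = ⊗-identityˡ , ⊗-identityʳ
      ; distrib = ⊗-distribˡ-⊕ , ⊗-distribʳ-⊕
      }
    ; *-comm = ⊗-comm
    }
  }

x-ℝy≡x⊕⊖y : ∀ x y → x -ℝ y ≡ x ⊕ ⊖ y
x-ℝy≡x⊕⊖y x y = trans (+ℝ≡⊕ x (-ℝ y)) (cong (x ⊕_) (-ℝ≡⊖ y))

fromℚ-cong : ∀ {p q} → p ≡ q → fromℚ p ≃ fromℚ q
fromℚ-cong p≡q = ≃-pointwise λ _ → p≡q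

ℝ-almostCommutativeRing : AlmostCommutativeRing 0ℓ 0ℓ
ℝ-almostCommutativeRing = fromCommutativeRing ℝ-commutativeRing

-- The coefficients are rational because the polarisation of P₂ involves ½ and its discriminant
-- identity ¼.
fromℚ-morphism : ℚ.+-*-rawRing -Raw-AlmostCommutative⟶ ℝ-almostCommutativeRing
fromℚ-morphism = record
  { ⟦_⟧    = fromℚ
  ; +-homo = fromℚ-+
  ; *-homo = fromℚ-*
  ; -‿homo = fromℚ-neg
  ; 0-homo = ≃-refl
  ; 1-homo = ≃-refl
  }

fromℚ-≟ : ∀ p q → Maybe (fromℚ p ≃ fromℚ q)
fromℚ-≟ p q with p ℚₚ.≟ q
... | yes p≡q = just (fromℚ-cong p≡q)
... | no  _   = nothing

module ℝ-Solver =
  RingSolver ℚ.+-*-rawRing ℝ-almostCommutativeRing fromℚ-morphism fromℚ-≟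

-- Order on ℝ

module _ where
  open +-*-Solver
  open ℚₚ.≤-Reasoning

  opaque
    unfolding _⊕_

    -- A strict inequality survives an error of half its gap, the other half being the new gap. This
    -- serves both the invariance of positivity under `_≃_` and the addition of a nonnegative
    -- number.
    half-gap : ∀ g p q → 0ℚ ℚ.+ g ℚ.< p → p ℚ.< q ℚ.+ g ℚ.* ½ → 0ℚ ℚ.+ g ℚ.* ½ ℚ.< q
    half-gap g p q g<p p<q+g/2 = begin-strict
      0ℚ ℚ.+ g ℚ.* ½
        ≡⟨ solve 1 (λ h → con 0ℚ :+ h := (h :+ h) :- h) refl (g ℚ.* ½) ⟩
      (g ℚ.* ½ ℚ.+ g ℚ.* ½) ℚ.- g ℚ.* ½
        ≡⟨ cong (ℚ._- g ℚ.* ½) (trans (halve g) (sym (ℚₚ.+-identityˡ g))) ⟩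
      (0ℚ ℚ.+ g) ℚ.- g ℚ.* ½
        <⟨ ℚₚ.+-monoˡ-< (ℚ.- (g ℚ.* ½)) (ℚₚ.<-trans g<p p<q+g/2) ⟩
      (q ℚ.+ g ℚ.* ½) ℚ.- g ℚ.* ½
        ≡⟨ solve 2 (λ b h → (b :+ h) :- h := b) refl q (g ℚ.* ½) ⟩
      q ∎

    pos-resp-≃ : ∀ {x y} → x ≃ y → 0ℝ <ℝ x → 0ℝ <ℝ y
    pos-resp-≃ {x} {y} h (mk< g 0<g below) = mk< (g ℚ.* ½) (half-pos 0<g)
      (eventually-zip
        (λ n g<x d → half-gap g (seq x n) (seq y n) g<x (∣-∣<⇒< (seq x n) (seq y n) d))
        below (close h (g ℚ.* ½) (half-pos 0<g)))

    pos+nonNeg : ∀ {x y} → 0ℝ <ℝ x → 0ℝ ≤ℝ y → 0ℝ <ℝ x ⊕ y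
    pos+nonNeg {x} {y} (mk< g 0<g below) (mk≤ above) = mk< (g ℚ.* ½) (half-pos 0<g)
      (eventually-zip
        (λ n g<x -g/2<y → half-gap g (seq x n) (seq x n ℚ.+ seq y n) g<x
          (subst₂ ℚ._<_ (ℚₚ.+-identityʳ (seq x n)) (sym (ℚₚ.+-assoc (seq x n) (seq y n) (g ℚ.* ½)))
            (ℚₚ.+-monoʳ-< (seq x n) -g/2<y)))
        below (above (g ℚ.* ½) (half-pos 0<g)))

    pos*pos : ∀ {x y} → 0ℝ <ℝ x → 0ℝ <ℝ y → 0ℝ <ℝ x ⊗ y
    pos*pos {x} {y} (mk< g 0<g g<) (mk< h 0<h h<) =
      mk< (g ℚ.* h)
        (ℚₚ.positive⁻¹ (g ℚ.* h) {{ℚₚ.pos*pos⇒pos g {{ℚ.positive 0<g}} h {{ℚ.positive 0<h}}}})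
        (eventually-zip (λ n g<x h<y → below (seq x n) (seq y n)
          (subst (ℚ._< seq x n) (ℚₚ.+-identityˡ g) g<x)
          (subst (ℚ._< seq y n) (ℚₚ.+-identityˡ h) h<y)) g< h<)
      where
      below : ∀ p q → g ℚ.< p → h ℚ.< q → 0ℚ ℚ.+ g ℚ.* h ℚ.< p ℚ.* q
      below p q g<p h<q = begin-strict
        0ℚ ℚ.+ g ℚ.* h ≡⟨ ℚₚ.+-identityˡ (g ℚ.* h) ⟩
        g ℚ.* h        <⟨ ℚₚ.*-monoʳ-<-pos g {{ℚ.positive 0<g}} h<q ⟩
        g ℚ.* q        <⟨ ℚₚ.*-monoˡ-<-pos q {{ℚ.positive (ℚₚ.<-trans 0<h h<q)}} g<p ⟩
        p ℚ.* q        ∎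

    ¬pos-0 : ¬ (0ℝ <ℝ 0ℝ)
    ¬pos-0 (mk< g 0<g (N , below)) =
      ℚₚ.<-irrefl refl (ℚₚ.<-trans 0<g (subst (ℚ._< 0ℚ) (ℚₚ.+-identityˡ g) (below N ℕₚ.≤-refl)))

    -- This makes case distinctions under a double negation usable: an inequality may be proved by
    -- refutation. One rational comparison decides, that of a late term plus ε / 2 with 0. If the
    -- sum is negative, the whole tail stays below it and `⊖ x` is positive, which is excluded.
    ¬neg⇒nonNeg : ∀ {x} → ¬ (0ℝ <ℝ ⊖ x) → 0ℝ ≤ℝ x
    ¬neg⇒nonNeg {x} ¬neg = mk≤ λ ε 0<ε → go ε 0<ε (cauchy x (ε ℚ.* ½) (half-pos 0<ε))
      where
      go : ∀ ε → 0ℚ ℚ.< ε →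
        (∃ λ N → ∀ m n → N ℕ.≤ m → N ℕ.≤ n → ℚ.∣ seq x m ℚ.- seq x n ∣ ℚ.< ε ℚ.* ½) →
        Eventually λ n → 0ℚ ℚ.< seq x n ℚ.+ ε
      go ε 0<ε (N , near) = [ right , left ]′ (≤-<-connex 0ℚ (seq x N ℚ.+ ε ℚ.* ½))
        where
        r : ℚ
        r = seq x N ℚ.+ ε ℚ.* ½
        left : r ℚ.< 0ℚ → Eventually λ n → 0ℚ ℚ.< seq x n ℚ.+ ε
        left r<0 = contradiction
          (mk< (ℚ.- r) (ℚₚ.neg-antimono-< {r} {0ℚ} r<0) (N , λ n N≤n →
            subst (ℚ._< ℚ.- seq x n) (sym (ℚₚ.+-identityˡ (ℚ.- r)))
              (ℚₚ.neg-antimono-< {seq x n} {r}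
                (∣-∣<⇒> (seq x N) (seq x n) (near N n ℕₚ.≤-refl N≤n)))))
          ¬neg
        right : 0ℚ ℚ.≤ r → Eventually λ n → 0ℚ ℚ.< seq x n ℚ.+ ε
        right 0≤r = N , λ n N≤n → begin-strict
          0ℚ
            ≤⟨ 0≤r ⟩
          seq x N ℚ.+ ε ℚ.* ½
            <⟨ ℚₚ.+-monoˡ-< (ε ℚ.* ½) (∣-∣<⇒< (seq x N) (seq x n) (near N n ℕₚ.≤-refl N≤n)) ⟩
          (seq x n ℚ.+ ε ℚ.* ½) ℚ.+ ε ℚ.* ½
            ≡⟨ trans (ℚₚ.+-assoc (seq x n) (ε ℚ.* ½) (ε ℚ.* ½)) (cong (seq x n ℚ.+_) (halve ε)) ⟩
          seq x n ℚ.+ ε ∎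

    nonNeg∧nonPos⇒≃0 : ∀ {x} → 0ℝ ≤ℝ x → 0ℝ ≤ℝ ⊖ x → x ≃ 0ℝ
    nonNeg∧nonPos⇒≃0 {x} (mk≤ lower) (mk≤ upper) = mk≃ λ ε 0<ε →
      eventually-zip (λ n → small (seq x n)) (lower ε 0<ε) (upper ε 0<ε)
      where
      small : ∀ p {ε} → 0ℚ ℚ.< p ℚ.+ ε → 0ℚ ℚ.< ℚ.- p ℚ.+ ε → ℚ.∣ p ℚ.- 0ℚ ∣ ℚ.< ε
      small p {ε} l u rewrite ℚₚ.+-identityʳ p with ℚₚ.∣p∣≡p∨∣p∣≡-p p
      ... | inj₁ ∣p∣≡p = subst (ℚ._< ε) (sym ∣p∣≡p) (subst₂ ℚ._<_ (ℚₚ.+-identityʳ p)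
        (solve 2 (λ a e → a :+ (:- a :+ e) := e) refl p ε) (ℚₚ.+-monoʳ-< p u))
      ... | inj₂ ∣p∣≡-p = subst (ℚ._< ε) (sym ∣p∣≡-p) (subst₂ ℚ._<_ (ℚₚ.+-identityʳ (ℚ.- p))
        (solve 2 (λ a e → :- a :+ (a :+ e) := e) refl p ε) (ℚₚ.+-monoʳ-< (ℚ.- p) l))

    pos⇒nonNeg : ∀ {x} → 0ℝ <ℝ x → 0ℝ ≤ℝ x
    pos⇒nonNeg {x} (mk< g 0<g below) = mk≤ λ ε 0<ε → eventually-map
      (λ n g<x → ℚₚ.+-mono-< (ℚₚ.<-trans 0<g (subst (ℚ._< seq x n) (ℚₚ.+-identityˡ g) g<x)) 0<ε)
      below

    ≤⇒nonNeg : ∀ {x y} → x ≤ℝ y → 0ℝ ≤ℝ y ⊕ ⊖ x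
    ≤⇒nonNeg {x} {y} (mk≤ below) = mk≤ λ ε 0<ε → eventually-map
      (λ n x<y+ε → subst₂ ℚ._<_ (ℚₚ.+-inverseʳ (seq x n))
        (solve 3 (λ a b e → (b :+ e) :- a := (b :- a) :+ e) refl (seq x n) (seq y n) ε)
        (ℚₚ.+-monoˡ-< (ℚ.- seq x n) x<y+ε)) (below ε 0<ε)

    nonNeg⇒≤ : ∀ {x y} → 0ℝ ≤ℝ y ⊕ ⊖ x → x ≤ℝ y
    nonNeg⇒≤ {x} {y} (mk≤ below) = mk≤ λ ε 0<ε → eventually-map
      (λ n 0<y-x+ε → subst₂ ℚ._<_ (ℚₚ.+-identityʳ (seq x n))
        (solve 3 (λ a b e → a :+ ((b :- a) :+ e) := b :+ e) refl (seq x n) (seq y n) ε)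
        (ℚₚ.+-monoʳ-< (seq x n) 0<y-x+ε)) (below ε 0<ε)

    neg⇒pos : ∀ {x} → x <ℝ 0ℝ → 0ℝ <ℝ ⊖ x
    neg⇒pos {x} (mk< g 0<g below) = mk< g 0<g (eventually-map
      (λ n x+g<0 → subst₂ ℚ._<_
        (solve 2 (λ a h → (a :+ h) :- a := con 0ℚ :+ h) refl (seq x n) g)
        (ℚₚ.+-identityˡ (ℚ.- seq x n))
        (ℚₚ.+-monoˡ-< (ℚ.- seq x n) x+g<0)) below)

module _ where
  open ℝ-Solver

  0<1 : 0ℝ <ℝ 1ℝ
  0<1 = mk< ½ (ℚₚ.positive⁻¹ ½) (0 , λ _ _ → ℚ.*<* (ℤ.+<+ (s≤s (s≤s z≤n))))

  fromℚ-nonNeg : ∀ {q} → 0ℚ ℚ.≤ q → 0ℝ ≤ℝ fromℚ q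
  fromℚ-nonNeg 0≤q = mk≤ λ ε 0<ε → 0 , λ _ _ → ℚₚ.+-mono-≤-< 0≤q 0<ε

  pos⇒≄0 : ∀ {x} → 0ℝ <ℝ x → ¬ (x ≃ 0ℝ)
  pos⇒≄0 0<x x≃0 = ¬pos-0 (pos-resp-≃ x≃0 0<x)

  nonNeg⇒¬neg : ∀ {x} → 0ℝ ≤ℝ x → ¬ (0ℝ <ℝ ⊖ x)
  nonNeg⇒¬neg {x} 0≤x 0<-x =
    pos⇒≄0 (pos+nonNeg 0<-x 0≤x) (solve 1 (λ a → :- a :+ a := con 0ℚ) ≃-refl x)

  nonNeg-resp-≃ : ∀ {x y} → x ≃ y → 0ℝ ≤ℝ x → 0ℝ ≤ℝ y
  nonNeg-resp-≃ x≃y 0≤x =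
    ¬neg⇒nonNeg λ 0<-y → nonNeg⇒¬neg 0≤x (pos-resp-≃ (⊖-cong (≃-sym x≃y)) 0<-y)

  nonNeg+nonNeg : ∀ {x y} → 0ℝ ≤ℝ x → 0ℝ ≤ℝ y → 0ℝ ≤ℝ x ⊕ y
  nonNeg+nonNeg {x} {y} 0≤x 0≤y = ¬neg⇒nonNeg λ 0<-[x+y] → nonNeg⇒¬neg 0≤x
    (pos-resp-≃ (solve 2 (λ a b → :- (a :+ b) :+ b := :- a) ≃-refl x y) (pos+nonNeg 0<-[x+y] 0≤y))

  ¬pos⇒nonPos : ∀ {x} → ¬ (0ℝ <ℝ x) → 0ℝ ≤ℝ ⊖ x
  ¬pos⇒nonPos {x} ¬0<x = ¬neg⇒nonNeg λ 0<--x →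
    ¬0<x (pos-resp-≃ (solve 1 (λ a → :- (:- a) := a) ≃-refl x) 0<--x)

  ¬pos∧¬neg⇒≃0 : ∀ {x} → ¬ (0ℝ <ℝ x) → ¬ (0ℝ <ℝ ⊖ x) → x ≃ 0ℝ
  ¬pos∧¬neg⇒≃0 ¬0<x ¬0<-x = nonNeg∧nonPos⇒≃0 (¬neg⇒nonNeg ¬0<-x) (¬pos⇒nonPos ¬0<x)

  nonNeg⇒¬¬pos : ∀ {x} → 0ℝ ≤ℝ x → ¬ (x ≃ 0ℝ) → ¬ ¬ (0ℝ <ℝ x)
  nonNeg⇒¬¬pos 0≤x x≄0 ¬0<x = x≄0 (¬pos∧¬neg⇒≃0 ¬0<x (nonNeg⇒¬neg 0≤x))

  ⊗-zeroˡ : ∀ {x} y → x ≃ 0ℝ → x ⊗ y ≃ 0ℝ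
  ⊗-zeroˡ y x≃0 = ≃-trans (⊗-cong x≃0 ≃-refl) (solve 1 (λ a → con 0ℚ :* a := con 0ℚ) ≃-refl y)

  ⊗-zeroʳ : ∀ x {y} → y ≃ 0ℝ → x ⊗ y ≃ 0ℝ
  ⊗-zeroʳ x {y} y≃0 = ≃-trans (⊗-comm x y) (⊗-zeroˡ x y≃0)

  ⊖-zero : ∀ {x} → x ≃ 0ℝ → ⊖ x ≃ 0ℝ
  ⊖-zero x≃0 = ≃-trans (⊖-cong x≃0) (solve 0 (:- con 0ℚ := con 0ℚ) ≃-refl)

  ⊕-zero : ∀ {x y} → x ≃ 0ℝ → y ≃ 0ℝ → x ⊕ y ≃ 0ℝ
  ⊕-zero x≃0 y≃0 = ≃-trans (⊕-cong x≃0 y≃0) (⊕-identityˡ 0ℝ)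

  -- A negative product would make both factors nonzero, hence positive up to double negation; since
  -- the goal is by then absurdity, the double negations can be removed.
  nonNeg*nonNeg : ∀ {x y} → 0ℝ ≤ℝ x → 0ℝ ≤ℝ y → 0ℝ ≤ℝ x ⊗ y
  nonNeg*nonNeg {x} {y} 0≤x 0≤y = ¬neg⇒nonNeg λ 0<-xy →
    nonNeg⇒¬¬pos 0≤x (λ x≃0 → pos⇒≄0 0<-xy (⊖-zero (⊗-zeroˡ y x≃0))) λ 0<x →
    nonNeg⇒¬¬pos 0≤y (λ y≃0 → pos⇒≄0 0<-xy (⊖-zero (⊗-zeroʳ x y≃0))) λ 0<y →
    nonNeg⇒¬neg (pos⇒nonNeg (pos*pos 0<x 0<y)) 0<-xy

  -- A negative square refutes both signs of `x`, so `x` and with it the square would be 0.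
  nonNeg-square : ∀ x → 0ℝ ≤ℝ x ⊗ x
  nonNeg-square x = ¬neg⇒nonNeg λ 0<-x² → pos⇒≄0 0<-x² (⊖-zero (⊗-zeroˡ x (¬pos∧¬neg⇒≃0
    (λ 0<x → nonNeg⇒¬neg (pos⇒nonNeg (pos*pos 0<x 0<x)) 0<-x²)
    (λ 0<-x → nonNeg⇒¬neg (pos⇒nonNeg (pos-resp-≃
      (solve 1 (λ a → :- a :* :- a := a :* a) ≃-refl x) (pos*pos 0<-x 0<-x))) 0<-x²))))

  square≃0 : ∀ {x} → x ⊗ x ≃ 0ℝ → x ≃ 0ℝ
  square≃0 {x} x²≃0 = ¬pos∧¬neg⇒≃0
    (λ 0<x → pos⇒≄0 (pos*pos 0<x 0<x) x²≃0)
    (λ 0<-x → pos⇒≄0 (pos*pos 0<-x 0<-x)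
      (≃-trans (solve 1 (λ a → :- a :* :- a := a :* a) ≃-refl x) x²≃0))

  nonNeg+nonNeg≃0 : ∀ {x y} → 0ℝ ≤ℝ x → 0ℝ ≤ℝ y → x ⊕ y ≃ 0ℝ → x ≃ 0ℝ
  nonNeg+nonNeg≃0 {x} {y} 0≤x 0≤y x+y≃0 = ¬pos∧¬neg⇒≃0
    (λ 0<x → pos⇒≄0 (pos+nonNeg 0<x 0≤y) x+y≃0) (nonNeg⇒¬neg 0≤x)

-- The ring of complex numbers

infixl 6 _⊞_
infixl 7 _⊠_
infix  8 ⊟_

_⊞_ _⊠_ : ℂ → ℂ → ℂ
z ⊞ w = (re z ⊕ re w) +i (im z ⊕ im w)
z ⊠ w = (re z ⊗ re w ⊕ ⊖ (im z ⊗ im w)) +i (re z ⊗ im w ⊕ im z ⊗ re w)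

⊟_ : ℂ → ℂ
⊟ z = (⊖ re z) +i (⊖ im z)

1ℂ : ℂ
1ℂ = ofReal 1ℝ

+ℂ≡⊞ : ∀ z w → z +ℂ w ≡ z ⊞ w
+ℂ≡⊞ z w = cong₂ _+i_ (+ℝ≡⊕ (re z) (re w)) (+ℝ≡⊕ (im z) (im w))

*ℂ≡⊠ : ∀ z w → z *ℂ w ≡ z ⊠ w
*ℂ≡⊠ z w = cong₂ _+i_
  (trans (x-ℝy≡x⊕⊖y (re z *ℝ re w) (im z *ℝ im w))
    (cong₂ (λ x y → x ⊕ ⊖ y) (*ℝ≡⊗ (re z) (re w)) (*ℝ≡⊗ (im z) (im w))))
  (trans (+ℝ≡⊕ (re z *ℝ im w) (im z *ℝ re w))
    (cong₂ _⊕_ (*ℝ≡⊗ (re z) (im w)) (*ℝ≡⊗ (im z) (re w))))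

module _ where
  open ℝ-Solver

  ⊠-assoc : ∀ x y z → (x ⊠ y) ⊠ z ≃ℂ x ⊠ (y ⊠ z)
  ⊠-assoc (a +i b) (c +i d) (e +i f) =
    solve 6 (λ a b c d e f →
      (a :* c :+ :- (b :* d)) :* e :+ :- ((a :* d :+ b :* c) :* f) :=
      a :* (c :* e :+ :- (d :* f)) :+ :- (b :* (c :* f :+ d :* e))) ≃-refl a b c d e f ,
    solve 6 (λ a b c d e f →
      (a :* c :+ :- (b :* d)) :* f :+ (a :* d :+ b :* c) :* e :=
      a :* (c :* f :+ d :* e) :+ b :* (c :* e :+ :- (d :* f))) ≃-refl a b c d e f

  ⊠-comm : ∀ x y → x ⊠ y ≃ℂ y ⊠ x
  ⊠-comm (a +i b) (c +i d) =
    solve 4 (λ a b c d → a :* c :+ :- (b :* d) := c :* a :+ :- (d :* b)) ≃-refl a b c d ,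
    solve 4 (λ a b c d → a :* d :+ b :* c := c :* b :+ d :* a) ≃-refl a b c d

  ⊠-identityˡ : ∀ x → 1ℂ ⊠ x ≃ℂ x
  ⊠-identityˡ (a +i b) =
    solve 2 (λ a b → con 1ℚ :* a :+ :- (con 0ℚ :* b) := a) ≃-refl a b ,
    solve 2 (λ a b → con 1ℚ :* b :+ con 0ℚ :* a := b) ≃-refl a b

  ⊠-identityʳ : ∀ x → x ⊠ 1ℂ ≃ℂ x
  ⊠-identityʳ (a +i b) =
    solve 2 (λ a b → a :* con 1ℚ :+ :- (b :* con 0ℚ) := a) ≃-refl a b ,
    solve 2 (λ a b → a :* con 0ℚ :+ b :* con 1ℚ := b) ≃-refl a b

  ⊠-distribˡ-⊞ : ∀ x y z → x ⊠ (y ⊞ z) ≃ℂ x ⊠ y ⊞ x ⊠ z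
  ⊠-distribˡ-⊞ (a +i b) (c +i d) (e +i f) =
    solve 6 (λ a b c d e f → a :* (c :+ e) :+ :- (b :* (d :+ f)) :=
      (a :* c :+ :- (b :* d)) :+ (a :* e :+ :- (b :* f))) ≃-refl a b c d e f ,
    solve 6 (λ a b c d e f → a :* (d :+ f) :+ b :* (c :+ e) :=
      (a :* d :+ b :* c) :+ (a :* f :+ b :* e)) ≃-refl a b c d e f

  ⊠-distribʳ-⊞ : ∀ x y z → (y ⊞ z) ⊠ x ≃ℂ y ⊠ x ⊞ z ⊠ x
  ⊠-distribʳ-⊞ (a +i b) (c +i d) (e +i f) =
    solve 6 (λ a b c d e f → (c :+ e) :* a :+ :- ((d :+ f) :* b) :=
      (c :* a :+ :- (d :* b)) :+ (e :* a :+ :- (f :* b))) ≃-refl a b c d e f ,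
    solve 6 (λ a b c d e f → (c :+ e) :* b :+ (d :+ f) :* a :=
      (c :* b :+ d :* a) :+ (e :* b :+ f :* a)) ≃-refl a b c d e f

⊞-cong : ∀ {x y u v} → x ≃ℂ y → u ≃ℂ v → x ⊞ u ≃ℂ y ⊞ v
⊞-cong (p , q) (r , s) = ⊕-cong p r , ⊕-cong q s

⊠-cong : ∀ {x y u v} → x ≃ℂ y → u ≃ℂ v → x ⊠ u ≃ℂ y ⊠ v
⊠-cong (p , q) (r , s) =
  ⊕-cong (⊗-cong p r) (⊖-cong (⊗-cong q s)) , ⊕-cong (⊗-cong p s) (⊗-cong q r)

ℂ-commutativeRing : CommutativeRing 0ℓ 0ℓ
ℂ-commutativeRing = record
  { Carrier = ℂ
  ; _≈_ = _≃ℂ_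
  ; _+_ = _⊞_
  ; _*_ = _⊠_
  ; -_ = ⊟_
  ; 0# = 0ℂ
  ; 1# = 1ℂ
  ; isCommutativeRing = record
    { isRing = record
      { +-isAbelianGroup = record
        { isGroup = record
          { isMonoid = record
            { isSemigroup = record
              { isMagma = record
                { isEquivalence = record
                  { refl  = ≃-refl , ≃-refl
                  ; sym   = λ (p , q) → ≃-sym p , ≃-sym q
                  ; trans = λ (p , q) (r , s) → ≃-trans p r , ≃-trans q s
                  }
                ; ∙-cong = ⊞-cong
                }
              ; assoc = λ x y z → ⊕-assoc (re x) (re y) (re z) , ⊕-assoc (im x) (im y) (im z)
              }
            ; identity = (λ x → ⊕-identityˡ (re x) , ⊕-identityˡ (im x))
                       , (λ x → ⊕-identityʳ (re x) , ⊕-identityʳ (im x))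
            }
          ; inverse = (λ x → ⊖-inverseˡ (re x) , ⊖-inverseˡ (im x))
                    , (λ x → ⊖-inverseʳ (re x) , ⊖-inverseʳ (im x))
          ; ⁻¹-cong = λ (p , q) → ⊖-cong p , ⊖-cong q
          }
        ; comm = λ x y → ⊕-comm (re x) (re y) , ⊕-comm (im x) (im y)
        }
      ; *-cong = ⊠-cong
      ; *-assoc = ⊠-assoc
      ; *-identity = ⊠-identityˡ , ⊠-identityʳ
      ; distrib = ⊠-distribˡ-⊞ , ⊠-distribʳ-⊞
      }
    ; *-comm = ⊠-comm
    }
  }

ofReal-⊕ : ∀ x y → ofReal (x ⊕ y) ≃ℂ ofReal x ⊞ ofReal y
ofReal-⊕ x y = ≃-refl , ≃-sym (⊕-identityˡ 0ℝ)

ofReal-⊗ : ∀ x y → ofReal (x ⊗ y) ≃ℂ ofReal x ⊠ ofReal y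
ofReal-⊗ x y =
  solve 2 (λ a b → a :* b := a :* b :+ :- (con 0ℚ :* con 0ℚ)) ≃-refl x y ,
  solve 2 (λ a b → con 0ℚ := a :* con 0ℚ :+ con 0ℚ :* b) ≃-refl x y
  where open ℝ-Solver

ofReal-⊖ : ∀ x → ofReal (⊖ x) ≃ℂ ⊟ ofReal x
ofReal-⊖ x = ≃-refl , ≃-sym (⊖-zero ≃-refl)

ofReal-cong : ∀ {x y} → x ≃ y → ofReal x ≃ℂ ofReal y
ofReal-cong x≃y = x≃y , ≃-refl

module ℂᵣ = CommutativeRing ℂ-commutativeRing

ofℚ : ℚ → ℂ
ofℚ q = ofReal (fromℚ q)

ofℚ-morphism : ℚ.+-*-rawRing -Raw-AlmostCommutative⟶ fromCommutativeRing ℂ-commutativeRing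
ofℚ-morphism = record
  { ⟦_⟧    = ofℚ
  ; +-homo = λ p q → ℂᵣ.trans (ofReal-cong (fromℚ-+ p q)) (ofReal-⊕ (fromℚ p) (fromℚ q))
  ; *-homo = λ p q → ℂᵣ.trans (ofReal-cong (fromℚ-* p q)) (ofReal-⊗ (fromℚ p) (fromℚ q))
  ; -‿homo = λ p → ℂᵣ.trans (ofReal-cong (fromℚ-neg p)) (ofReal-⊖ (fromℚ p))
  ; 0-homo = ℂᵣ.refl
  ; 1-homo = ℂᵣ.refl
  }

ofℚ-≟ : ∀ p q → Maybe (ofℚ p ≃ℂ ofℚ q)
ofℚ-≟ p q with p ℚₚ.≟ q
... | yes p≡q = just (ofReal-cong (fromℚ-cong p≡q))
... | no  _   = nothing

module ℂ-Solver =
  RingSolver ℚ.+-*-rawRing (fromCommutativeRing ℂ-commutativeRing) ofℚ-morphism ofℚ-≟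

module ≃-Reasoning = SetoidReasoning (CommutativeRing.setoid ℝ-commutativeRing)
module ≃ℂ-Reasoning = SetoidReasoning (CommutativeRing.setoid ℂ-commutativeRing)

-- Imaginary parts of quotients without division

-- Im (x ȳ)
cross : ℂ → ℂ → ℝ
cross x y = im x ⊗ re y ⊕ ⊖ (re x ⊗ im y)

normSq : ℂ → ℝ
normSq x = re x ⊗ re x ⊕ im x ⊗ im x

cross-cong : ∀ {x y u v} → x ≃ℂ y → u ≃ℂ v → cross x u ≃ cross y v
cross-cong (p , q) (r , s) = ⊕-cong (⊗-cong q r) (⊖-cong (⊗-cong p s))

cross-zeroˡ : ∀ {x} y → x ≃ℂ 0ℂ → cross x y ≃ 0ℝ
cross-zeroˡ y (p , q) = ⊕-zero (⊗-zeroˡ (re y) q) (⊖-zero (⊗-zeroˡ (im y) p))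

normSq-nonNeg : ∀ x → 0ℝ ≤ℝ normSq x
normSq-nonNeg x = nonNeg+nonNeg (nonNeg-square (re x)) (nonNeg-square (im x))

normSq≃0 : ∀ {x} → normSq x ≃ 0ℝ → x ≃ℂ 0ℂ
normSq≃0 {x} h =
  square≃0 (nonNeg+nonNeg≃0 (nonNeg-square (re x)) (nonNeg-square (im x)) h) ,
  square≃0 (nonNeg+nonNeg≃0 (nonNeg-square (im x)) (nonNeg-square (re x))
    (≃-trans (⊕-comm (im x ⊗ im x) (re x ⊗ re x)) h))

normSq-¬¬pos : ∀ {x} → ¬ (x ≃ℂ 0ℂ) → ¬ ¬ (0ℝ <ℝ normSq x)
normSq-¬¬pos {x} x≄0 = nonNeg⇒¬¬pos (normSq-nonNeg x) λ h → x≄0 (normSq≃0 h)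

module _ where
  open ℝ-Solver

  -- The map z ↦ - 1 / z preserves the upper half-plane.
  cross-⊟-swap : ∀ x y → cross x y ≃ cross (⊟ y) x
  cross-⊟-swap (a +i b) (c +i d) =
    solve 4 (λ a b c d → b :* c :+ :- (a :* d) := :- d :* a :+ :- (:- c :* b)) ≃-refl a b c d

  cross-swap : ∀ x y → ⊖ cross x y ≃ cross y x
  cross-swap (a +i b) (c +i d) =
    solve 4 (λ a b c d → :- (b :* c :+ :- (a :* d)) := d :* a :+ :- (c :* b)) ≃-refl a b c d

  cross-⊞ˡ : ∀ x y w → cross (x ⊞ y) w ≃ cross x w ⊕ cross y w
  cross-⊞ˡ (a +i b) (c +i d) (e +i f) =
    solve 6 (λ a b c d e f → (b :+ d) :* e :+ :- ((a :+ c) :* f) :=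
      (b :* e :+ :- (a :* f)) :+ (d :* e :+ :- (c :* f))) ≃-refl a b c d e f

  cross-self-⊞ : ∀ x y → cross (x ⊞ y) x ≃ cross y x
  cross-self-⊞ (a +i b) (c +i d) =
    solve 4 (λ a b c d → (b :+ d) :* a :+ :- ((a :+ c) :* b) := d :* a :+ :- (c :* b))
      ≃-refl a b c d

  -- A common factor cancels in the quotient; with the denominators cleared it leaves its squared
  -- modulus.
  cross-⊠ˡ : ∀ w x y → cross (w ⊠ x) (w ⊠ y) ≃ normSq w ⊗ cross x y
  cross-⊠ˡ (a +i b) (c +i d) (e +i f) =
    solve 6 (λ a b c d e f →
      (a :* d :+ b :* c) :* (a :* e :+ :- (b :* f)) :+
        :- ((a :* c :+ :- (b :* d)) :* (a :* f :+ b :* e)) :=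
      (a :* a :+ b :* b) :* (d :* e :+ :- (c :* f))) ≃-refl a b c d e f

  cross-⊠ʳ : ∀ v w x → cross (v ⊠ x) (w ⊠ x) ≃ normSq x ⊗ cross v w
  cross-⊠ʳ (a +i b) (c +i d) (e +i f) =
    solve 6 (λ a b c d e f →
      (a :* f :+ b :* e) :* (c :* e :+ :- (d :* f)) :+
        :- ((a :* e :+ :- (b :* f)) :* (c :* f :+ d :* e)) :=
      (e :* e :+ f :* f) :* (b :* c :+ :- (a :* d))) ≃-refl a b c d e f

  cross-⊞ʳ : ∀ x y w → cross w (x ⊞ y) ≃ cross w x ⊕ cross w y
  cross-⊞ʳ (a +i b) (c +i d) (e +i f) =
    solve 6 (λ a b c d e f → f :* (a :+ c) :+ :- (e :* (b :+ d)) :=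
      (f :* a :+ :- (e :* b)) :+ (f :* c :+ :- (e :* d))) ≃-refl a b c d e f

  cross-ofReal : ∀ r x y → cross (ofReal r ⊠ x) y ≃ r ⊗ cross x y
  cross-ofReal r (a +i b) (c +i d) =
    solve 5 (λ r a b c d →
      (r :* b :+ con 0ℚ :* a) :* c :+ :- ((r :* a :+ :- (con 0ℚ :* b)) :* d) :=
      r :* (b :* c :+ :- (a :* d))) ≃-refl r a b c d

-- For real `r` and `s`, the map z ↦ r z + s multiplies imaginary parts by `r`. This is what
-- excludes nonreal zeros of the linear polynomials below.
cross-affine : ∀ r s x y → cross (ofReal r ⊠ x ⊞ ofReal s ⊠ y) y ≃ r ⊗ cross x y
cross-affine r s x y = begin
  cross (ofReal r ⊠ x ⊞ ofReal s ⊠ y) y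
    ≈⟨ cross-⊞ˡ (ofReal r ⊠ x) (ofReal s ⊠ y) y ⟩
  cross (ofReal r ⊠ x) y ⊕ cross (ofReal s ⊠ y) y
    ≈⟨ ⊕-cong (cross-ofReal r x y) (cross-ofReal s y y) ⟩
  r ⊗ cross x y ⊕ s ⊗ cross y y
    ≈⟨ solve 4 (λ t s a b → t :+ s :* (b :* a :+ :- (a :* b)) := t) ≃-refl
         (r ⊗ cross x y) s (re y) (im y) ⟩
  r ⊗ cross x y ∎
  where
  open ≃-Reasoning
  open ℝ-Solver

-- Multi-affine polynomials in n variables: A +x· B is A + x B with x the first one.
infix 5 _+x·_

data MultiAffine : ℕ → Set where
  const : ℂ → MultiAffine 0
  _+x·_ : ∀ {n} → MultiAffine n → MultiAffine n → MultiAffine (suc n)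

infixl 6 _+ₘ_
infixr 7 _·ₘ_

_+ₘ_ : ∀ {n} → MultiAffine n → MultiAffine n → MultiAffine n
const a    +ₘ const b    = const (a ⊞ b)
(A +x· B)  +ₘ (C +x· E)  = (A +ₘ C) +x· (B +ₘ E)

_·ₘ_ : ∀ {n} → ℂ → MultiAffine n → MultiAffine n
c ·ₘ const a   = const (c ⊠ a)
c ·ₘ (A +x· B) = (c ·ₘ A) +x· (c ·ₘ B)

-- The sum of all partial derivatives.
∂ : ∀ {n} → MultiAffine n → MultiAffine n
∂ (const _)  = const 0ℂ
∂ (A +x· B) = (∂ A +ₘ B) +x· ∂ B

-- Homogeneous coordinates: a point is a list of pairs (u , v) standing for u / v.
Point : ℕ → Set
Point = Vec (ℂ × ℂ)

eval : ∀ {n} → MultiAffine n → Point n → ℂ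
eval (const a)  []             = a
eval (A +x· B) ((u , v) ∷ zs) = v ⊠ eval A zs ⊞ u ⊠ eval B zs

-- Since `cross u v` is |v|² Im (u / v), its positivity also forces `u` and `v` to be nonzero.
Upper : ∀ {n} → Point n → Set
Upper = All λ (u , v) → 0ℝ <ℝ cross u v

Stable : ∀ {n} → MultiAffine n → Set
Stable F = ∀ zs → Upper zs → ¬ (eval F zs ≃ℂ 0ℂ)

module _ where
  open ℂ-Solver
  open ≃ℂ-Reasoning

  eval-+ₘ : ∀ {n} (F G : MultiAffine n) zs → eval (F +ₘ G) zs ≃ℂ eval F zs ⊞ eval G zs
  eval-+ₘ (const a)  (const b)  []             = ℂᵣ.refl
  eval-+ₘ (A +x· B) (C +x· E) ((u , v) ∷ zs) = begin
    v ⊠ eval (A +ₘ C) zs ⊞ u ⊠ eval (B +ₘ E) zs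
      ≈⟨ ℂᵣ.+-cong (ℂᵣ.*-congˡ (eval-+ₘ A C zs)) (ℂᵣ.*-congˡ (eval-+ₘ B E zs)) ⟩
    v ⊠ (eval A zs ⊞ eval C zs) ⊞ u ⊠ (eval B zs ⊞ eval E zs)
      ≈⟨ solve 6 (λ u v a b c e → v :* (a :+ c) :+ u :* (b :+ e) :=
           (v :* a :+ u :* b) :+ (v :* c :+ u :* e)) ℂᵣ.refl
           u v (eval A zs) (eval B zs) (eval C zs) (eval E zs) ⟩
    (v ⊠ eval A zs ⊞ u ⊠ eval B zs) ⊞ (v ⊠ eval C zs ⊞ u ⊠ eval E zs) ∎

  eval-·ₘ : ∀ {n} c (F : MultiAffine n) zs → eval (c ·ₘ F) zs ≃ℂ c ⊠ eval F zs
  eval-·ₘ c (const a)  []             = ℂᵣ.refl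
  eval-·ₘ c (A +x· B) ((u , v) ∷ zs) = begin
    v ⊠ eval (c ·ₘ A) zs ⊞ u ⊠ eval (c ·ₘ B) zs
      ≈⟨ ℂᵣ.+-cong (ℂᵣ.*-congˡ (eval-·ₘ c A zs)) (ℂᵣ.*-congˡ (eval-·ₘ c B zs)) ⟩
    v ⊠ (c ⊠ eval A zs) ⊞ u ⊠ (c ⊠ eval B zs)
      ≈⟨ solve 5 (λ c u v a b → v :* (c :* a) :+ u :* (c :* b) := c :* (v :* a :+ u :* b))
           ℂᵣ.refl c u v (eval A zs) (eval B zs) ⟩
    c ⊠ (v ⊠ eval A zs ⊞ u ⊠ eval B zs) ∎

  eval-∂-+ₘ : ∀ {n} (F G : MultiAffine n) zs →
    eval (∂ (F +ₘ G)) zs ≃ℂ eval (∂ F) zs ⊞ eval (∂ G) zs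
  eval-∂-+ₘ (const a)  (const b)  [] = ℂᵣ.sym (ℂᵣ.+-identityˡ 0ℂ)
  eval-∂-+ₘ (A +x· B) (C +x· E) ((u , v) ∷ zs) = begin
    v ⊠ eval (∂ (A +ₘ C) +ₘ (B +ₘ E)) zs ⊞ u ⊠ eval (∂ (B +ₘ E)) zs
      ≈⟨ ℂᵣ.+-cong
           (ℂᵣ.*-congˡ (ℂᵣ.trans (eval-+ₘ (∂ (A +ₘ C)) (B +ₘ E) zs)
             (ℂᵣ.+-cong (eval-∂-+ₘ A C zs) (eval-+ₘ B E zs))))
           (ℂᵣ.*-congˡ (eval-∂-+ₘ B E zs)) ⟩
    v ⊠ ((∂a ⊞ ∂c) ⊞ (b ⊞ e)) ⊞ u ⊠ (∂b ⊞ ∂e)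
      ≈⟨ solve 8 (λ u v ∂a ∂b ∂c ∂e b e →
           v :* ((∂a :+ ∂c) :+ (b :+ e)) :+ u :* (∂b :+ ∂e) :=
           (v :* (∂a :+ b) :+ u :* ∂b) :+ (v :* (∂c :+ e) :+ u :* ∂e))
           ℂᵣ.refl u v ∂a ∂b ∂c ∂e b e ⟩
    (v ⊠ (∂a ⊞ b) ⊞ u ⊠ ∂b) ⊞ (v ⊠ (∂c ⊞ e) ⊞ u ⊠ ∂e)
      ≈⟨ ℂᵣ.+-cong (ℂᵣ.+-congʳ (ℂᵣ.*-congˡ (eval-+ₘ (∂ A) B zs)))
                   (ℂᵣ.+-congʳ (ℂᵣ.*-congˡ (eval-+ₘ (∂ C) E zs))) ⟨
    eval (∂ (A +x· B)) ((u , v) ∷ zs) ⊞ eval (∂ (C +x· E)) ((u , v) ∷ zs) ∎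
    where
    ∂a = eval (∂ A) zs ; ∂b = eval (∂ B) zs ; ∂c = eval (∂ C) zs ; ∂e = eval (∂ E) zs
    b = eval B zs ; e = eval E zs

  eval-∂-·ₘ : ∀ {n} c (F : MultiAffine n) zs → eval (∂ (c ·ₘ F)) zs ≃ℂ c ⊠ eval (∂ F) zs
  eval-∂-·ₘ c (const a)  [] = ℂᵣ.sym (ℂᵣ.zeroʳ c)
  eval-∂-·ₘ c (A +x· B) ((u , v) ∷ zs) = begin
    v ⊠ eval (∂ (c ·ₘ A) +ₘ c ·ₘ B) zs ⊞ u ⊠ eval (∂ (c ·ₘ B)) zs
      ≈⟨ ℂᵣ.+-cong
           (ℂᵣ.*-congˡ (ℂᵣ.trans (eval-+ₘ (∂ (c ·ₘ A)) (c ·ₘ B) zs)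
             (ℂᵣ.+-cong (eval-∂-·ₘ c A zs) (eval-·ₘ c B zs))))
           (ℂᵣ.*-congˡ (eval-∂-·ₘ c B zs)) ⟩
    v ⊠ (c ⊠ ∂a ⊞ c ⊠ b) ⊞ u ⊠ (c ⊠ ∂b)
      ≈⟨ solve 6 (λ c u v ∂a ∂b b →
           v :* (c :* ∂a :+ c :* b) :+ u :* (c :* ∂b) := c :* (v :* (∂a :+ b) :+ u :* ∂b))
           ℂᵣ.refl c u v ∂a ∂b b ⟩
    c ⊠ (v ⊠ (∂a ⊞ b) ⊞ u ⊠ ∂b)
      ≈⟨ ℂᵣ.*-congˡ (ℂᵣ.+-congʳ (ℂᵣ.*-congˡ (eval-+ₘ (∂ A) B zs))) ⟨
    c ⊠ eval (∂ (A +x· B)) ((u , v) ∷ zs) ∎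
    where
    ∂a = eval (∂ A) zs ; ∂b = eval (∂ B) zs ; b = eval B zs

  -- The first variable is set to u / v and the denominator cleared. For a point of the upper
  -- half-plane this preserves stability, which permits an induction on the number of variables.
  specialise : ∀ {n} → MultiAffine (suc n) → ℂ × ℂ → MultiAffine n
  specialise (A +x· B) (u , v) = v ·ₘ A +ₘ u ·ₘ B

  eval-specialise : ∀ {n} (F : MultiAffine (suc n)) z zs →
    eval (specialise F z) zs ≃ℂ eval F (z ∷ zs)
  eval-specialise (A +x· B) (u , v) zs =
    ℂᵣ.trans (eval-+ₘ (v ·ₘ A) (u ·ₘ B) zs) (ℂᵣ.+-cong (eval-·ₘ v A zs) (eval-·ₘ u B zs))

  -- The derivative in the first variable is B, homogenised to v B because ∂ F is still evaluated as
  -- a polynomial of degree at most 1 in that variable; the other derivatives commute with fixing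
  -- it.
  eval-∂ : ∀ {n} (A B : MultiAffine n) u v zs →
    eval (∂ (A +x· B)) ((u , v) ∷ zs) ≃ℂ
    eval (∂ (specialise (A +x· B) (u , v))) zs ⊞ v ⊠ eval B zs
  eval-∂ A B u v zs = begin
    v ⊠ eval (∂ A +ₘ B) zs ⊞ u ⊠ ∂b
      ≈⟨ ℂᵣ.+-congʳ (ℂᵣ.*-congˡ (eval-+ₘ (∂ A) B zs)) ⟩
    v ⊠ (∂a ⊞ b) ⊞ u ⊠ ∂b
      ≈⟨ solve 5 (λ u v ∂a ∂b b →
           v :* (∂a :+ b) :+ u :* ∂b := (v :* ∂a :+ u :* ∂b) :+ v :* b)
           ℂᵣ.refl u v ∂a ∂b b ⟩
    (v ⊠ ∂a ⊞ u ⊠ ∂b) ⊞ v ⊠ b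
      ≈⟨ ℂᵣ.+-congʳ (ℂᵣ.trans (eval-∂-+ₘ (v ·ₘ A) (u ·ₘ B) zs)
           (ℂᵣ.+-cong (eval-∂-·ₘ v A zs) (eval-∂-·ₘ u B zs))) ⟨
    eval (∂ (specialise (A +x· B) (u , v))) zs ⊞ v ⊠ b ∎
    where
    ∂a = eval (∂ A) zs ; ∂b = eval (∂ B) zs ; b = eval B zs

  -- If Im (B Ā) > 0 then A + x B vanishes at x = - A / B, which is in the upper half-plane.
  stable⇒cross-nonPos : ∀ {n} (A B : MultiAffine n) → Stable (A +x· B) →
    ∀ zs → Upper zs → 0ℝ ≤ℝ ⊖ cross (eval B zs) (eval A zs)
  stable⇒cross-nonPos A B stable zs upper = ¬pos⇒nonPos λ 0<cross →
    stable ((⊟ a , b) ∷ zs) (pos-resp-≃ (cross-⊟-swap b a) 0<cross ∷ upper)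
      (solve 2 (λ a b → b :* a :+ (:- a) :* b := con 0ℚ) ℂᵣ.refl a b)
    where
    a = eval A zs ; b = eval B zs

-- The contribution of v B to Im (∂ F / F). Of its two terms, one records where the root - A / B
-- lies and is controlled by stability; the other records where u / v lies and is the source of
-- strictness.
cross-head : ∀ a b u v →
  cross (v ⊠ b) (v ⊠ a ⊞ u ⊠ b) ≃ normSq v ⊗ cross b a ⊕ normSq b ⊗ cross v u
cross-head a b u v = ≃-trans (cross-⊞ʳ (v ⊠ a) (u ⊠ b) (v ⊠ b))
  (⊕-cong (cross-⊠ˡ v b a) (cross-⊠ʳ v u b))

mutual
  -- The bound that follows, with its positive term dropped; in this form it is applied to the
  -- remaining variables.
  cross-∂-nonPos : ∀ {n} (F : MultiAffine n) → Stable F → ∀ zs → Upper zs →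
    0ℝ ≤ℝ ⊖ cross (eval (∂ F) zs) (eval F zs)
  cross-∂-nonPos (const a) _ [] _ =
    ¬pos⇒nonPos λ 0<cross → pos⇒≄0 0<cross (cross-zeroˡ a ℂᵣ.refl)
  cross-∂-nonPos (A +x· B) stable ((u , v) ∷ zs) upper@(0<uv ∷ _) =
    nonNeg-resp-≃ (solve 2 (λ a b → (a :+ :- b) :+ b := a) ≃-refl
        (⊖ cross (eval (∂ F) zs′) (eval F zs′)) (cross u v ⊗ normSq (eval B zs)))
      (nonNeg+nonNeg (cross-∂-bound A B stable u v zs upper)
        (nonNeg*nonNeg (pos⇒nonNeg 0<uv) (normSq-nonNeg (eval B zs))))
    where
    open ℝ-Solver
    F = A +x· B
    zs′ = (u , v) ∷ zs

  -- By `eval-∂` the left side splits into the same quantity for the specialised polynomial,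
  -- nonnegative by recursion on the number of variables, and the two terms of `cross-head`. The
  -- subtracted `cross u v ⊗ normSq (eval B zs)` cancels one of these exactly, and the other is
  -- nonnegative by stability.
  cross-∂-bound : ∀ {n} (A B : MultiAffine n) → Stable (A +x· B) →
    ∀ u v zs → Upper ((u , v) ∷ zs) →
    0ℝ ≤ℝ ⊖ cross (eval (∂ (A +x· B)) ((u , v) ∷ zs)) (eval (A +x· B) ((u , v) ∷ zs))
          ⊕ ⊖ (cross u v ⊗ normSq (eval B zs))
  cross-∂-bound A B stable u v zs (0<uv ∷ upper) = nonNeg-resp-≃ (≃-sym decompose)
    (nonNeg+nonNeg
      (nonNeg-resp-≃ (⊖-cong (cross-cong ℂᵣ.refl (eval-specialise (A +x· B) (u , v) zs)))
        (cross-∂-nonPos G stable-G zs upper))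
      (nonNeg*nonNeg (normSq-nonNeg v) (stable⇒cross-nonPos A B stable zs upper)))
    where
    open ℝ-Solver
    open ≃-Reasoning
    G = specialise (A +x· B) (u , v)
    a = eval A zs ; b = eval B zs ; f = v ⊠ a ⊞ u ⊠ b ; ∂g = eval (∂ G) zs

    stable-G : Stable G
    stable-G ys upper-ys G≃0 = stable ((u , v) ∷ ys) (0<uv ∷ upper-ys)
      (ℂᵣ.trans (ℂᵣ.sym (eval-specialise (A +x· B) (u , v) ys)) G≃0)

    decompose : ⊖ cross (eval (∂ (A +x· B)) ((u , v) ∷ zs)) f ⊕ ⊖ (cross u v ⊗ normSq b) ≃
                ⊖ cross ∂g f ⊕ normSq v ⊗ ⊖ cross b a
    decompose = begin
      ⊖ cross (eval (∂ (A +x· B)) ((u , v) ∷ zs)) f ⊕ ⊖ (cross u v ⊗ normSq b)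
        ≈⟨ ⊕-cong (⊖-cong (≃-trans (cross-cong (eval-∂ A B u v zs) ℂᵣ.refl)
                           (≃-trans (cross-⊞ˡ ∂g (v ⊠ b) f) (⊕-cong ≃-refl (cross-head a b u v)))))
                  (⊖-cong (⊗-cong (≃-sym (cross-swap v u)) ≃-refl)) ⟩
      ⊖ (cross ∂g f ⊕ (normSq v ⊗ cross b a ⊕ normSq b ⊗ cross v u))
        ⊕ ⊖ (⊖ cross v u ⊗ normSq b)
        ≈⟨ solve 5 (λ x y z s t → :- (x :+ (y :* z :+ s :* t)) :+ :- (:- t :* s) :=
             :- x :+ y :* :- z) ≃-refl
             (cross ∂g f) (normSq v) (cross b a) (normSq b) (cross v u) ⟩
      ⊖ cross ∂g f ⊕ normSq v ⊗ ⊖ cross b a ∎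

-- Preservation of stability when a variable is added

-- On the diagonal, F ↦ (c + b x) F + b x F′, the new variable being x.
step : ∀ {n} → ℝ → ℝ → MultiAffine n → MultiAffine (suc n)
step c b F = (ofReal c ·ₘ F) +x· (ofReal b ·ₘ (F +ₘ ∂ F))

-- Stability of the leading coefficient in the first variable makes the inequalities strict.
StronglyStable : ∀ {n} → MultiAffine (suc n) → Set
StronglyStable (A +x· B) = Stable (A +x· B) × Stable B

-- Divided by x F, step c b F is c / x + b + b (∂ F) / F, whose imaginary part is negative
-- (after multiplication by b).
step-stable : ∀ {n} {c b} (F : MultiAffine (suc n)) → 0ℝ ≤ℝ c ⊗ b → 0ℝ <ℝ b ⊗ b →
  StronglyStable F → Stable (step c b F)
step-stable {_} {c} {b} F@(A +x· B) 0≤cb 0<bb (stable , stable-B)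
  ((w , v) ∷ (u₀ , v₀) ∷ zs) (0<wv ∷ upper@(0<u₀v₀ ∷ upper-zs)) value≃0 =
  -- The goal is absurdity, so the positivity of |w|² and |β|² is needed only up to double negation.
  normSq-¬¬pos (λ w≃0 → pos⇒≄0 0<wv (cross-zeroˡ v w≃0)) λ 0<∣w∣² →
  normSq-¬¬pos (stable-B zs upper-zs) λ 0<∣β∣² →
  pos⇒≄0
    (pos+nonNeg
      -- Adding the positive |β|² Im (u₀ v̄₀) to the bound leaves - Im (∂f f̄) itself, which is
      -- thereby strictly positive.
      (pos*pos (pos*pos 0<bb 0<∣w∣²) (pos-resp-≃ (cancel (cross u₀ v₀ ⊗ normSq β) (⊖ cross ∂f f))
        (pos+nonNeg (pos*pos 0<u₀v₀ 0<∣β∣²) (cross-∂-bound A B stable u₀ v₀ zs upper))))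
      (nonNeg*nonNeg 0≤cb (nonNeg*nonNeg (normSq-nonNeg f) (pos⇒nonNeg 0<wv))))
    vanishing
  where
  open ℝ-Solver
  open ≃-Reasoning
  f = eval F ((u₀ , v₀) ∷ zs)
  ∂f = eval (∂ F) ((u₀ , v₀) ∷ zs)
  β = eval B zs

  cancel : ∀ x y → x ⊕ (y ⊕ ⊖ x) ≃ y
  cancel = solve 2 (λ x y → x :+ (y :+ :- x) := y) ≃-refl

  value : eval (step c b F) ((w , v) ∷ (u₀ , v₀) ∷ zs) ≃ℂ
          ofReal c ⊠ (v ⊠ f) ⊞ ofReal b ⊠ (w ⊠ (f ⊞ ∂f))
  value = ℂᵣ.trans
    (ℂᵣ.+-cong (ℂᵣ.*-congˡ (eval-·ₘ (ofReal c) F ((u₀ , v₀) ∷ zs)))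
      (ℂᵣ.*-congˡ (ℂᵣ.trans (eval-·ₘ (ofReal b) (F +ₘ ∂ F) ((u₀ , v₀) ∷ zs))
        (ℂᵣ.*-congˡ (eval-+ₘ F (∂ F) ((u₀ , v₀) ∷ zs))))))
    (commute v (ofReal c) f w (ofReal b) (f ⊞ ∂f))
    where
    commute : ∀ v c f w b g → v ⊠ (c ⊠ f) ⊞ w ⊠ (b ⊠ g) ≃ℂ c ⊠ (v ⊠ f) ⊞ b ⊠ (w ⊠ g)
    commute = ℂ-Solver.solve 6 (λ v c f w b g →
      v ℂ-Solver.:* (c ℂ-Solver.:* f) ℂ-Solver.:+ w ℂ-Solver.:* (b ℂ-Solver.:* g) ℂ-Solver.:=
      c ℂ-Solver.:* (v ℂ-Solver.:* f) ℂ-Solver.:+ b ℂ-Solver.:* (w ℂ-Solver.:* g)) ℂᵣ.refl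

  -- Pairing with `w ⊠ f` stands for division by x F.
  cross-value : cross (ofReal c ⊠ (v ⊠ f) ⊞ ofReal b ⊠ (w ⊠ (f ⊞ ∂f))) (w ⊠ f) ≃
                c ⊗ (normSq f ⊗ cross v w) ⊕ b ⊗ (normSq w ⊗ cross ∂f f)
  cross-value = ≃-trans
    (cross-⊞ˡ (ofReal c ⊠ (v ⊠ f)) (ofReal b ⊠ (w ⊠ (f ⊞ ∂f))) (w ⊠ f))
    (⊕-cong
      (≃-trans (cross-ofReal c (v ⊠ f) (w ⊠ f)) (⊗-cong ≃-refl (cross-⊠ʳ v w f)))
      (≃-trans (cross-ofReal b (w ⊠ (f ⊞ ∂f)) (w ⊠ f)) (⊗-cong ≃-refl
        (≃-trans (cross-⊠ˡ w (f ⊞ ∂f) f) (⊗-cong ≃-refl (cross-self-⊞ f ∂f))))))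

  -- The factor `⊖ b` makes b² and c b the only coefficients whose signs enter, so both signs of β
  -- are treated at once.
  vanishing : b ⊗ b ⊗ normSq w ⊗ ⊖ cross ∂f f ⊕ c ⊗ b ⊗ (normSq f ⊗ cross w v) ≃ 0ℝ
  vanishing = begin
    b ⊗ b ⊗ normSq w ⊗ ⊖ cross ∂f f ⊕ c ⊗ b ⊗ (normSq f ⊗ cross w v)
      ≈⟨ ⊕-cong ≃-refl (⊗-cong ≃-refl (⊗-cong ≃-refl (cross-swap v w))) ⟨
    b ⊗ b ⊗ normSq w ⊗ ⊖ cross ∂f f ⊕ c ⊗ b ⊗ (normSq f ⊗ ⊖ cross v w)
      ≈⟨ solve 6 (λ b c W D N K → b :* b :* W :* :- D :+ c :* b :* (N :* :- K) :=
           :- b :* (c :* (N :* K) :+ b :* (W :* D))) ≃-refl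
           b c (normSq w) (cross ∂f f) (normSq f) (cross v w) ⟩
    ⊖ b ⊗ (c ⊗ (normSq f ⊗ cross v w) ⊕ b ⊗ (normSq w ⊗ cross ∂f f))
      ≈⟨ ⊗-zeroʳ (⊖ b) (≃-trans (≃-sym cross-value)
           (cross-zeroˡ (w ⊠ f) (ℂᵣ.trans (ℂᵣ.sym value) value≃0))) ⟩
    0ℝ ∎

-- The new leading coefficient b (F + ∂ F), multiplied by the new variable, is the step with c = 0.
-- At the value i of that variable its nonvanishing is therefore another instance of `step-stable`.
step-stronglyStable : ∀ {n} {c b} (F : MultiAffine (suc n)) → 0ℝ ≤ℝ c ⊗ b → 0ℝ <ℝ b ⊗ b →
  StronglyStable F → StronglyStable (step c b F)
step-stronglyStable {_} {c} {b} F 0≤cb 0<bb stable = step-stable F 0≤cb 0<bb stable , top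
  where
  i : ℂ
  i = 0ℝ +i 1ℝ
  0≤0b : 0ℝ ≤ℝ 0ℝ ⊗ b
  0≤0b = nonNeg-resp-≃ (≃-sym (⊗-zeroˡ b ≃-refl)) 0≤0
    where
    0≤0 : 0ℝ ≤ℝ 0ℝ
    0≤0 = ¬neg⇒nonNeg λ h → pos⇒≄0 h (⊖-zero ≃-refl)
  0<i : 0ℝ <ℝ cross i 1ℂ
  0<i = pos-resp-≃ (solve 0 (con 1ℚ := con 1ℚ :* con 1ℚ :+ :- (con 0ℚ :* con 0ℚ)) ≃-refl) 0<1
    where open ℝ-Solver
  top : Stable (ofReal b ·ₘ (F +ₘ ∂ F))
  top zs upper top≃0 = step-stable {c = 0ℝ} {b} F 0≤0b 0<bb stable
    ((i , 1ℂ) ∷ zs) (0<i ∷ upper)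
    (ℂᵣ.trans (ℂᵣ.+-cong
        (ℂᵣ.*-congˡ {1ℂ} (ℂᵣ.trans (eval-·ₘ 0ℂ F zs) (ℂᵣ.zeroˡ (eval F zs))))
        (ℂᵣ.*-congˡ {i} top≃0))
      (ℂᵣ.trans (ℂᵣ.+-cong (ℂᵣ.zeroʳ 1ℂ) (ℂᵣ.zeroʳ i)) (ℂᵣ.+-identityˡ 0ℂ)))

-- Formal power series and the equation (1 - t) f′ = h

module PowerSeries (S : CommutativeSemiring 0ℓ 0ℓ) where
  open CommutativeSemiring S hiding (zero; refl; sym; trans)
  private module ≈ = CommutativeSemiring S
  open SetoidReasoning setoid
  open SemiringSolver S using (solve; _:=_; _:+_; _:*_; con)

  ∑ : ℕ → (ℕ → Carrier) → Carrier
  ∑ zero    f = f 0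
  ∑ (suc n) f = ∑ n f + f (suc n)

  ∑-cong-≤ : ∀ n {f g} → (∀ k → k ℕ.≤ n → f k ≈ g k) → ∑ n f ≈ ∑ n g
  ∑-cong-≤ zero    h = h 0 z≤n
  ∑-cong-≤ (suc n) h =
    +-cong (∑-cong-≤ n λ k k≤n → h k (ℕₚ.m≤n⇒m≤1+n k≤n)) (h (suc n) ℕₚ.≤-refl)

  ∑-cong : ∀ n {f g} → (∀ k → f k ≈ g k) → ∑ n f ≈ ∑ n g
  ∑-cong n h = ∑-cong-≤ n λ k _ → h k

  ∑-0 : ∀ n {f} → (∀ k → k ℕ.≤ n → f k ≈ 0#) → ∑ n f ≈ 0#
  ∑-0 zero    h = h 0 z≤n
  ∑-0 (suc n) h = ≈.trans
    (+-cong (∑-0 n λ k k≤n → h k (ℕₚ.m≤n⇒m≤1+n k≤n)) (h (suc n) ℕₚ.≤-refl))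
    (+-identityˡ 0#)

  ∑-+ : ∀ n f g → ∑ n (λ k → f k + g k) ≈ ∑ n f + ∑ n g
  ∑-+ zero    f g = ≈.refl
  ∑-+ (suc n) f g = ≈.trans (+-congʳ (∑-+ n f g))
    (solve 4 (λ a b c d → (a :+ b) :+ (c :+ d) := (a :+ c) :+ (b :+ d)) ≈.refl
      (∑ n f) (∑ n g) (f (suc n)) (g (suc n)))

  ∑-* : ∀ n c f → ∑ n (λ k → c * f k) ≈ c * ∑ n f
  ∑-* zero    c f = ≈.refl
  ∑-* (suc n) c f = ≈.trans (+-congʳ (∑-* n c f)) (≈.sym (distribˡ c (∑ n f) (f (suc n))))

  ∑-swap : ∀ m n (f : ℕ → ℕ → Carrier) → ∑ m (λ j → ∑ n (f j)) ≈ ∑ n (λ k → ∑ m (λ j → f j k))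
  ∑-swap zero    n f = ≈.refl
  ∑-swap (suc m) n f = ≈.trans (+-congʳ (∑-swap m n f))
    (≈.sym (∑-+ n (λ k → ∑ m (λ j → f j k)) (f (suc m))))

  ∑-head : ∀ n f → ∑ (suc n) f ≈ f 0 + ∑ n (λ k → f (suc k))
  ∑-head zero    f = ≈.refl
  ∑-head (suc n) f = ≈.trans (+-congʳ (∑-head n f)) (+-assoc _ _ _)

  ∑-extend : ∀ m n {f} → m ℕ.≤ n → (∀ k → m ℕ.< k → f k ≈ 0#) → ∑ m f ≈ ∑ n f
  ∑-extend m n m≤n h with ℕₚ.m≤n⇒m<n∨m≡n m≤n
  ... | inj₂ refl = ≈.refl
  ∑-extend m (suc n) {f} _ h | inj₁ (s≤s m≤n) = begin
    ∑ m f             ≈⟨ ∑-extend m n m≤n h ⟩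
    ∑ n f             ≈⟨ +-identityʳ (∑ n f) ⟨
    ∑ n f + 0#        ≈⟨ +-congˡ (h (suc n) (s≤s m≤n)) ⟨
    ∑ n f + f (suc n) ∎

  infixl 7 _⋆_

  _⋆_ : (ℕ → Carrier) → (ℕ → Carrier) → ℕ → Carrier
  (f ⋆ g) n = ∑ n λ k → f k * g (n ∸ k)

  δ : ℕ → Carrier
  δ zero    = 1#
  δ (suc _) = 0#

  power : (ℕ → Carrier) → ℕ → ℕ → Carrier
  power f zero    = δ
  power f (suc k) = f ⋆ power f k

  scalarPower : Carrier → ℕ → Carrier
  scalarPower z zero    = 1#
  scalarPower z (suc k) = z * scalarPower z k

  ⋆-cong : ∀ {f g h k} → (∀ n → f n ≈ g n) → (∀ n → h n ≈ k n) → ∀ n → (f ⋆ h) n ≈ (g ⋆ k) n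
  ⋆-cong p q n = ∑-cong n λ k → *-cong (p k) (q (n ∸ k))

  power-cong : ∀ {f g} → (∀ n → f n ≈ g n) → ∀ k n → power f k n ≈ power g k n
  power-cong h zero    n = ≈.refl
  power-cong h (suc k) n = ⋆-cong h (power-cong h k) n

  ⋆-distribʳ : ∀ f g h n → ((λ i → f i + g i) ⋆ h) n ≈ (f ⋆ h) n + (g ⋆ h) n
  ⋆-distribʳ f g h n = ≈.trans (∑-cong n λ k → distribʳ (h (n ∸ k)) (f k) (g k))
    (∑-+ n (λ k → f k * h (n ∸ k)) (λ k → g k * h (n ∸ k)))

  ⋆-distribˡ : ∀ f g h n → (f ⋆ (λ i → g i + h i)) n ≈ (f ⋆ g) n + (f ⋆ h) n
  ⋆-distribˡ f g h n = ≈.trans (∑-cong n λ k → distribˡ (f k) (g (n ∸ k)) (h (n ∸ k)))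
    (∑-+ n (λ k → f k * g (n ∸ k)) (λ k → f k * h (n ∸ k)))

  ⋆-scaleˡ : ∀ c f g n → ((λ i → c * f i) ⋆ g) n ≈ c * (f ⋆ g) n
  ⋆-scaleˡ c f g n = ≈.trans (∑-cong n λ k → *-assoc c (f k) (g (n ∸ k)))
    (∑-* n c (λ k → f k * g (n ∸ k)))

  ⋆-scaleʳ : ∀ c f g n → (f ⋆ (λ i → c * g i)) n ≈ c * (f ⋆ g) n
  ⋆-scaleʳ c f g n = ≈.trans
    (∑-cong n λ k → solve 3 (λ c x y → x :* (c :* y) := c :* (x :* y)) ≈.refl c (f k) (g (n ∸ k)))
    (∑-* n c (λ k → f k * g (n ∸ k)))

  ⋆-identityˡ : ∀ f n → (δ ⋆ f) n ≈ f n
  ⋆-identityˡ f zero    = *-identityˡ (f 0)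
  ⋆-identityˡ f (suc n) = begin
    (δ ⋆ f) (suc n)                                ≈⟨ ∑-head n (λ k → δ k * f (suc n ∸ k)) ⟩
    1# * f (suc n) + ∑ n (λ k → 0# * f (n ∸ k))    ≈⟨ +-cong (*-identityˡ _) (∑-0 n λ k _ → zeroˡ _) ⟩
    f (suc n) + 0#                                 ≈⟨ +-identityʳ _ ⟩
    f (suc n)                                      ∎

  -- The series u starts at t, so its k-th power starts at t^k: in the convolution u₀ kills the
  -- first summand, and every other one uses the previous power at an index lowered by at least one.
  power-vanish : ∀ u → u 0 ≈ 0# → ∀ k m → m ℕ.< k → power u k m ≈ 0#
  power-vanish u u₀ (suc k) m (s≤s m≤k) = ∑-0 m λ
    { zero    _       → ≈.trans (*-congʳ u₀) (zeroˡ _)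
    ; (suc i) (s≤s {n = m′} _) → ≈.trans (*-congˡ (power-vanish u u₀ k (m′ ∸ i)
        (ℕₚ.≤-trans (s≤s (ℕₚ.m∸n≤m m′ i)) m≤k))) (zeroʳ _)
    }

  power-scale : ∀ z u k n → power (λ i → z * u i) k n ≈ scalarPower z k * power u k n
  power-scale z u zero    n = ≈.sym (*-identityˡ _)
  power-scale z u (suc k) n = begin
    ((λ i → z * u i) ⋆ power (λ i → z * u i) k) n
      ≈⟨ ⋆-cong (λ _ → ≈.refl) (power-scale z u k) n ⟩
    ((λ i → z * u i) ⋆ (λ i → scalarPower z k * power u k i)) n
      ≈⟨ ⋆-scaleˡ z u (λ i → scalarPower z k * power u k i) n ⟩
    z * (u ⋆ (λ i → scalarPower z k * power u k i)) n
      ≈⟨ *-congˡ (⋆-scaleʳ (scalarPower z k) u (power u k) n) ⟩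
    z * (scalarPower z k * power u (suc k) n)
      ≈⟨ *-assoc _ _ _ ⟨
    scalarPower z (suc k) * power u (suc k) n ∎

  module Derivation (nat : ℕ → Carrier) (nat-0 : nat 0 ≈ 0#)
                    (nat-suc : ∀ n → nat (suc n) ≈ 1# + nat n) where

    nat-+ : ∀ m n → nat (m ℕ.+ n) ≈ nat m + nat n
    nat-+ zero    n = ≈.sym (≈.trans (+-congʳ nat-0) (+-identityˡ (nat n)))
    nat-+ (suc m) n = begin
      nat (suc (m ℕ.+ n))      ≈⟨ nat-suc (m ℕ.+ n) ⟩
      1# + nat (m ℕ.+ n)       ≈⟨ +-congˡ (nat-+ m n) ⟩
      1# + (nat m + nat n)     ≈⟨ +-assoc _ _ _ ⟨
      (1# + nat m) + nat n     ≈⟨ +-congʳ (nat-suc m) ⟨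
      nat (suc m) + nat n      ∎

    -- The operator t d/dt keeps indices in place, so its Leibniz rule holds summand by summand: the
    -- weight n is the sum of the weights k and n - k. The rule for `deriv` follows by a shift, the
    -- terms of weight 0 dropping out.
    euler : (ℕ → Carrier) → ℕ → Carrier
    euler f n = nat n * f n

    deriv : (ℕ → Carrier) → ℕ → Carrier
    deriv f n = euler f (suc n)

    euler-⋆ : ∀ f g n → euler (f ⋆ g) n ≈ (euler f ⋆ g) n + (f ⋆ euler g) n
    euler-⋆ f g n = begin
      nat n * (f ⋆ g) n
        ≈⟨ ∑-* n (nat n) (λ k → f k * g (n ∸ k)) ⟨
      ∑ n (λ k → nat n * (f k * g (n ∸ k)))
        ≈⟨ ∑-cong-≤ n (λ k k≤n → begin
             nat n * (f k * g (n ∸ k))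
               ≡⟨ cong (λ i → nat i * (f k * g (n ∸ k))) (sym (ℕₚ.m+[n∸m]≡n k≤n)) ⟩
             nat (k ℕ.+ (n ∸ k)) * (f k * g (n ∸ k))
               ≈⟨ *-congʳ (nat-+ k (n ∸ k)) ⟩
             (nat k + nat (n ∸ k)) * (f k * g (n ∸ k))
               ≈⟨ solve 4 (λ a b x y → (a :+ b) :* (x :* y) := (a :* x) :* y :+ x :* (b :* y))
                    ≈.refl (nat k) (nat (n ∸ k)) (f k) (g (n ∸ k)) ⟩
             euler f k * g (n ∸ k) + f k * euler g (n ∸ k) ∎) ⟩
      ∑ n (λ k → euler f k * g (n ∸ k) + f k * euler g (n ∸ k))
        ≈⟨ ∑-+ n _ _ ⟩
      (euler f ⋆ g) n + (f ⋆ euler g) n ∎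

    euler-0 : ∀ f → euler f 0 ≈ 0#
    euler-0 f = ≈.trans (*-congʳ nat-0) (zeroˡ (f 0))

    deriv-⋆ : ∀ f g n → deriv (f ⋆ g) n ≈ (deriv f ⋆ g) n + (f ⋆ deriv g) n
    deriv-⋆ f g n = ≈.trans (euler-⋆ f g (suc n)) (+-cong left right)
      where
      left : (euler f ⋆ g) (suc n) ≈ (deriv f ⋆ g) n
      left = begin
        (euler f ⋆ g) (suc n)
          ≈⟨ ∑-head n (λ k → euler f k * g (suc n ∸ k)) ⟩
        euler f 0 * g (suc n) + (deriv f ⋆ g) n
          ≈⟨ +-congʳ (≈.trans (*-congʳ (euler-0 f)) (zeroˡ _)) ⟩
        0# + (deriv f ⋆ g) n
          ≈⟨ +-identityˡ _ ⟩
        (deriv f ⋆ g) n ∎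
      right : (f ⋆ euler g) (suc n) ≈ (f ⋆ deriv g) n
      right = begin
        ∑ n (λ k → f k * euler g (suc n ∸ k)) + f (suc n) * euler g (n ∸ n)
          ≈⟨ +-cong
               (∑-cong-≤ n λ k k≤n → reflexive (cong (λ i → f k * euler g i) (ℕₚ.+-∸-assoc 1 k≤n)))
               (≈.trans (*-congˡ (≈.trans (reflexive (cong (euler g) (ℕₚ.n∸n≡0 n))) (euler-0 g)))
                        (zeroʳ _)) ⟩
        (f ⋆ deriv g) n + 0#
          ≈⟨ +-identityʳ _ ⟩
        (f ⋆ deriv g) n ∎

    -- (1 - t) f′ = h
    _Solves_ : (f h : ℕ → Carrier) → Set
    f Solves h = ∀ n → deriv f n ≈ euler f n + h n

    ⋆-solves : ∀ {f g h k} → f Solves h → g Solves k →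
      (f ⋆ g) Solves (λ n → (h ⋆ g) n + (f ⋆ k) n)
    ⋆-solves {f} {g} {h} {k} sf sg n = begin
      deriv (f ⋆ g) n
        ≈⟨ deriv-⋆ f g n ⟩
      (deriv f ⋆ g) n + (f ⋆ deriv g) n
        ≈⟨ +-cong (⋆-cong {h = g} {g} sf (λ _ → ≈.refl) n) (⋆-cong {f} {f} (λ _ → ≈.refl) sg n) ⟩
      ((λ i → euler f i + h i) ⋆ g) n + (f ⋆ (λ i → euler g i + k i)) n
        ≈⟨ +-cong (⋆-distribʳ (euler f) h g n) (⋆-distribˡ f (euler g) k n) ⟩
      ((euler f ⋆ g) n + (h ⋆ g) n) + ((f ⋆ euler g) n + (f ⋆ k) n)
        ≈⟨ solve 4 (λ a b c d → (a :+ b) :+ (c :+ d) := (a :+ c) :+ (b :+ d)) ≈.refl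
             ((euler f ⋆ g) n) ((h ⋆ g) n) ((f ⋆ euler g) n) ((f ⋆ k) n) ⟩
      ((euler f ⋆ g) n + (f ⋆ euler g) n) + ((h ⋆ g) n + (f ⋆ k) n)
        ≈⟨ +-congʳ (euler-⋆ f g n) ⟨
      euler (f ⋆ g) n + ((h ⋆ g) n + (f ⋆ k) n) ∎

    euler-δ : ∀ n → euler δ n ≈ 0#
    euler-δ zero    = euler-0 δ
    euler-δ (suc n) = zeroʳ (nat (suc n))

    δ-solves : δ Solves (λ _ → 0#)
    δ-solves n = begin
      nat (suc n) * 0#     ≈⟨ zeroʳ _ ⟩
      0#                   ≈⟨ euler-δ n ⟨
      euler δ n            ≈⟨ +-identityʳ _ ⟨
      euler δ n + 0#       ∎

    -- For u = (1 - t)^β - 1 and b = - β.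
    module _ {u : ℕ → Carrier} {b : Carrier} (su : u Solves (λ n → b * (u n + δ n))) where

      -- From (1 - t) u′ = b (u + 1) follows (1 - t) (u^k)′ = b k (u^k + u^(k-1)); the separate case
      -- 0 avoids the exponent - 1.
      powerRHS : ℕ → ℕ → Carrier
      powerRHS zero    n = 0#
      powerRHS (suc k) n = (b * nat (suc k)) * (power u (suc k) n + power u k n)

      power-solves : ∀ k → power u k Solves powerRHS k
      power-solves zero    = δ-solves
      power-solves (suc k) n = ≈.trans (⋆-solves su (power-solves k) n) (+-congˡ (begin
        ((λ i → b * (u i + δ i)) ⋆ power u k) n + (u ⋆ powerRHS k) n
          ≈⟨ +-cong (⋆-scaleˡ b (λ i → u i + δ i) (power u k) n) (tail k) ⟩
        b * ((λ i → u i + δ i) ⋆ power u k) n + (b * nat k) * (power u (suc k) n + power u k n)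
          ≈⟨ +-congʳ (*-congˡ (≈.trans (⋆-distribʳ u δ (power u k) n)
               (+-congˡ (⋆-identityˡ (power u k) n)))) ⟩
        b * (power u (suc k) n + power u k n) + (b * nat k) * (power u (suc k) n + power u k n)
          ≈⟨ solve 3 (λ b k s → b :* s :+ (b :* k) :* s := (b :* (con 1 :+ k)) :* s) ≈.refl
               b (nat k) (power u (suc k) n + power u k n) ⟩
        (b * (1# + nat k)) * (power u (suc k) n + power u k n)
          ≈⟨ *-congʳ (*-congˡ (nat-suc k)) ⟨
        powerRHS (suc k) n ∎))
        where
        tail : ∀ k → (u ⋆ powerRHS k) n ≈ (b * nat k) * (power u (suc k) n + power u k n)
        tail zero    = ≈.trans (∑-0 n λ _ _ → zeroʳ _)
          (≈.sym (≈.trans (*-congʳ (≈.trans (*-congˡ nat-0) (zeroʳ b))) (zeroˡ _)))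
        tail (suc k) = ≈.trans
          (⋆-scaleʳ (b * nat (suc k)) u (λ i → power u (suc k) i + power u k i) n)
          (*-congˡ (⋆-distribˡ u (power u (suc k)) (power u k) n))

      -- For f = (1 - t)^α and a = - α.
      module _ {f : ℕ → Carrier} {a : Carrier} (sf : f Solves (λ n → a * f n))
               {fact ifact : ℕ → Carrier}
               (fact-suc  : ∀ n → fact (suc n) ≈ nat (suc n) * fact n)
               (ifact-suc : ∀ k → nat (suc k) * ifact (suc k) ≈ ifact k) where

        -- As exp (x u) = ∑ x^k u^k / k!, this is the coefficient of x^k in n! times the coefficient
        -- of t^n in f exp (x u).
        coefficient : ℕ → ℕ → Carrier
        coefficient n k = fact n * (ifact k * (f ⋆ power u k) n)

        private
          advance : ∀ n k → coefficient (suc n) k ≈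
            (fact n * ifact k) *
              (nat n * (f ⋆ power u k) n + (a * (f ⋆ power u k) n + (f ⋆ powerRHS k) n))
          advance n k = begin
            fact (suc n) * (ifact k * (f ⋆ power u k) (suc n))
              ≈⟨ *-congʳ (fact-suc n) ⟩
            (nat (suc n) * fact n) * (ifact k * (f ⋆ power u k) (suc n))
              ≈⟨ solve 4 (λ m x y z → (m :* x) :* (y :* z) := (x :* y) :* (m :* z)) ≈.refl
                   (nat (suc n)) (fact n) (ifact k) ((f ⋆ power u k) (suc n)) ⟩
            (fact n * ifact k) * deriv (f ⋆ power u k) n
              ≈⟨ *-congˡ (≈.trans (⋆-solves sf (power-solves k) n)
                   (+-congˡ (+-congʳ (⋆-scaleˡ a f (power u k) n)))) ⟩
            (fact n * ifact k) *
              (nat n * (f ⋆ power u k) n + (a * (f ⋆ power u k) n + (f ⋆ powerRHS k) n)) ∎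

        coefficient-suc-zero : ∀ n →
          coefficient (suc n) 0 ≈ (nat n + a) * coefficient n 0
        coefficient-suc-zero n = begin
          coefficient (suc n) 0
            ≈⟨ advance n 0 ⟩
          (fact n * ifact 0) * (nat n * s + (a * s + (f ⋆ powerRHS 0) n))
            ≈⟨ *-congˡ (+-congˡ (≈.trans (+-congˡ (∑-0 n λ _ _ → zeroʳ _)) (+-identityʳ _))) ⟩
          (fact n * ifact 0) * (nat n * s + a * s)
            ≈⟨ solve 5 (λ x y m a s → (x :* y) :* (m :* s :+ a :* s) := (m :+ a) :* (x :* (y :* s)))
                 ≈.refl (fact n) (ifact 0) (nat n) a s ⟩
          (nat n + a) * coefficient n 0 ∎
          where s = (f ⋆ power u 0) n

        -- The summand u^k of `powerRHS (suc k)` comes with the factor k + 1, which turns 1 / (k +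
        -- 1)! into 1 / k!. It thus yields the previous coefficient, that is, the multiplication by
        -- x in the recurrence.
        coefficient-suc-suc : ∀ n k →
          coefficient (suc n) (suc k) ≈
          (nat n + a) * coefficient n (suc k)
            + b * (coefficient n k + nat (suc k) * coefficient n (suc k))
        coefficient-suc-suc n k = begin
          coefficient (suc n) (suc k)
            ≈⟨ advance n (suc k) ⟩
          (x * y) * (m * s + (a * s + (f ⋆ powerRHS (suc k)) n))
            ≈⟨ *-congˡ (+-congˡ (+-congˡ (≈.trans
                 (⋆-scaleʳ (b * j) f (λ i → power u (suc k) i + power u k i) n)
                 (*-congˡ (⋆-distribˡ f (power u (suc k)) (power u k) n))))) ⟩
          (x * y) * (m * s + (a * s + (b * j) * (s + r)))
            ≈⟨ solve 8 (λ x y m s a b j r →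
                 (x :* y) :* (m :* s :+ (a :* s :+ (b :* j) :* (s :+ r))) :=
                 (m :+ a) :* (x :* (y :* s))
                   :+ b :* (x :* ((j :* y) :* r) :+ j :* (x :* (y :* s))))
                 ≈.refl x y m s a b j r ⟩
          (m + a) * (x * (y * s)) + b * (x * ((j * y) * r) + j * (x * (y * s)))
            ≈⟨ +-congˡ (*-congˡ (+-congʳ (*-congˡ (*-congʳ (ifact-suc k))))) ⟩
          (m + a) * (x * (y * s)) + b * (x * (ifact k * r) + j * (x * (y * s))) ∎
          where
          x = fact n ; y = ifact (suc k) ; m = nat n ; j = nat (suc k)
          s = (f ⋆ power u (suc k)) n ; r = (f ⋆ power u k) n

        -- The exponential is truncated at an index depending on the convolution variable. Since u₀
        -- = 0, every truncation can be extended to the common bound `n` by zero terms, after which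
        -- the two sums can be exchanged.
        generating-expansion : u 0 ≈ 0# → ∀ z n →
          fact n * (f ⋆ (λ m → ∑ m λ k → ifact k * power (λ i → z * u i) k m)) n ≈
          ∑ n (λ k → coefficient n k * scalarPower z k)
        generating-expansion u₀ z n = begin
          fact n * ∑ n (λ j → f j * ∑ (n ∸ j) (λ k → ifact k * power (λ i → z * u i) k (n ∸ j)))
            ≈⟨ *-congˡ (∑-cong n λ j → *-congˡ (inner j)) ⟩
          fact n * ∑ n (λ j → f j * ∑ n (λ k → c k * power u k (n ∸ j)))
            ≈⟨ *-congˡ (∑-cong n λ j → ∑-* n (f j) (λ k → c k * power u k (n ∸ j))) ⟨
          fact n * ∑ n (λ j → ∑ n (λ k → f j * (c k * power u k (n ∸ j))))
            ≈⟨ *-congˡ (∑-swap n n (λ j k → f j * (c k * power u k (n ∸ j)))) ⟩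
          fact n * ∑ n (λ k → (f ⋆ (λ m → c k * power u k m)) n)
            ≈⟨ *-congˡ (∑-cong n λ k → ⋆-scaleʳ (c k) f (power u k) n) ⟩
          fact n * ∑ n (λ k → c k * (f ⋆ power u k) n)
            ≈⟨ ∑-* n (fact n) (λ k → c k * (f ⋆ power u k) n) ⟨
          ∑ n (λ k → fact n * (c k * (f ⋆ power u k) n))
            ≈⟨ ∑-cong n (λ k → solve 4 (λ x y w s → x :* ((y :* w) :* s) := (x :* (y :* s)) :* w)
                 ≈.refl (fact n) (ifact k) (scalarPower z k) ((f ⋆ power u k) n)) ⟩
          ∑ n (λ k → coefficient n k * scalarPower z k) ∎
          where
          c : ℕ → Carrier
          c k = ifact k * scalarPower z k
          inner : ∀ j → ∑ (n ∸ j) (λ k → ifact k * power (λ i → z * u i) k (n ∸ j)) ≈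
                        ∑ n (λ k → c k * power u k (n ∸ j))
          inner j = ≈.trans
            (∑-cong (n ∸ j) λ k → ≈.trans (*-congˡ (power-scale z u k (n ∸ j)))
              (≈.sym (*-assoc _ _ _)))
            (∑-extend (n ∸ j) n (ℕₚ.m∸n≤m n j) λ k n∸j<k →
              ≈.trans (*-congˡ (power-vanish u u₀ k (n ∸ j) n∸j<k)) (zeroʳ _))

-- Casts of natural numbers and reciprocal factorials

toℚᵘ-/ : ∀ i n .{{_ : ℕ.NonZero n}} → ℚ.toℚᵘ (i ℚ./ n) ℚᵘ.≃ i ℚᵘ./ n
toℚᵘ-/ i (suc n) = ℚₚ.toℚᵘ-fromℚᵘ (mkℚᵘ i n)

-- A normalised fraction does not reduce when its numerator is a variable; between unnormalised
-- fractions the identity is one of integers.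
/1-suc : ∀ n → + suc n ℚ./ 1 ≡ 1ℚ ℚ.+ + n ℚ./ 1
/1-suc n = ℚₚ.toℚᵘ-injective (begin
  ℚ.toℚᵘ (+ suc n ℚ./ 1)               ≈⟨ toℚᵘ-/ (+ suc n) 1 ⟩
  mkℚᵘ (+ suc n) 0                     ≈⟨ ℚᵘ.*≡* (cong (λ i → (+ 1 ℤ.+ i) ℤ.* + 1) (sym (ℤₚ.*-identityʳ (+ n)))) ⟩
  mkℚᵘ (+ 1) 0 ℚᵘ.+ mkℚᵘ (+ n) 0       ≈⟨ ℚᵘₚ.+-congʳ (mkℚᵘ (+ 1) 0) (toℚᵘ-/ (+ n) 1) ⟨
  ℚ.toℚᵘ 1ℚ ℚᵘ.+ ℚ.toℚᵘ (+ n ℚ./ 1)    ≈⟨ ℚₚ.toℚᵘ-homo-+ 1ℚ (+ n ℚ./ 1) ⟨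
  ℚ.toℚᵘ (1ℚ ℚ.+ + n ℚ./ 1)            ∎)
  where open SetoidReasoning ℚᵘₚ.≃-setoid

/1-* : ∀ m n → + (m ℕ.* n) ℚ./ 1 ≡ (+ m ℚ./ 1) ℚ.* (+ n ℚ./ 1)
/1-* m n = ℚₚ.toℚᵘ-injective (begin
  ℚ.toℚᵘ (+ (m ℕ.* n) ℚ./ 1)                      ≈⟨ toℚᵘ-/ (+ (m ℕ.* n)) 1 ⟩
  mkℚᵘ (+ (m ℕ.* n)) 0                            ≈⟨ ℚᵘ.*≡* (cong (ℤ._* + 1) (ℤₚ.pos-* m n)) ⟩
  mkℚᵘ (+ m) 0 ℚᵘ.* mkℚᵘ (+ n) 0                  ≈⟨ ℚᵘₚ.*-cong (toℚᵘ-/ (+ m) 1) (toℚᵘ-/ (+ n) 1) ⟨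
  ℚ.toℚᵘ (+ m ℚ./ 1) ℚᵘ.* ℚ.toℚᵘ (+ n ℚ./ 1)      ≈⟨ ℚₚ.toℚᵘ-homo-* (+ m ℚ./ 1) (+ n ℚ./ 1) ⟨
  ℚ.toℚᵘ ((+ m ℚ./ 1) ℚ.* (+ n ℚ./ 1))            ∎)
  where open SetoidReasoning ℚᵘₚ.≃-setoid

/1-*-reciprocal : ∀ m n .{{_ : ℕ.NonZero n}} .{{_ : ℕ.NonZero (suc m ℕ.* n)}} →
  (+ suc m ℚ./ 1) ℚ.* (+ 1 ℚ./ (suc m ℕ.* n)) ≡ + 1 ℚ./ n
/1-*-reciprocal m (suc n) = ℚₚ.toℚᵘ-injective (begin
  ℚ.toℚᵘ ((+ suc m ℚ./ 1) ℚ.* (+ 1 ℚ./ (suc m ℕ.* suc n)))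
    ≈⟨ ℚₚ.toℚᵘ-homo-* (+ suc m ℚ./ 1) (+ 1 ℚ./ (suc m ℕ.* suc n)) ⟩
  ℚ.toℚᵘ (+ suc m ℚ./ 1) ℚᵘ.* ℚ.toℚᵘ (+ 1 ℚ./ (suc m ℕ.* suc n))
    ≈⟨ ℚᵘₚ.*-cong (toℚᵘ-/ (+ suc m) 1) (toℚᵘ-/ (+ 1) (suc m ℕ.* suc n)) ⟩
  mkℚᵘ (+ suc m) 0 ℚᵘ.* mkℚᵘ (+ 1) (n ℕ.+ m ℕ.* suc n)
    ≈⟨ ℚᵘ.*≡* (cong +_ (trans (cong (ℕ._* suc n) (ℕₚ.*-identityʳ (suc m)))
         (sym (trans (ℕₚ.*-identityˡ _) (ℕₚ.*-identityˡ _))))) ⟩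
  mkℚᵘ (+ 1) n
    ≈⟨ toℚᵘ-/ (+ 1) (suc n) ⟨
  ℚ.toℚᵘ (+ 1 ℚ./ suc n) ∎)
  where open SetoidReasoning ℚᵘₚ.≃-setoid

fromℕ-suc : ∀ n → fromℕ (suc n) ≃ 1ℝ ⊕ fromℕ n
fromℕ-suc n = ≃-trans (fromℚ-cong (/1-suc n)) (fromℚ-+ 1ℚ (+ n ℚ./ 1))

fromℕ-* : ∀ m n → fromℕ (m ℕ.* n) ≃ fromℕ m ⊗ fromℕ n
fromℕ-* m n = ≃-trans (fromℚ-cong (/1-* m n)) (fromℚ-* (+ m ℚ./ 1) (+ n ℚ./ 1))

1/fact-suc : ∀ k → fromℕ (suc k) ⊗ 1/fact (suc k) ≃ 1/fact k
1/fact-suc k = ≃-trans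
  (≃-sym (fromℚ-* (+ suc k ℚ./ 1) ((+ 1 ℚ./ (suc k !)) {{suc k ℕₚ.!≢0}})))
  (fromℚ-cong (/1-*-reciprocal k (k !) {{k ℕₚ.!≢0}} {{suc k ℕₚ.!≢0}}))

open PowerSeries ℂᵣ.commutativeSemiring

natℂ : ℕ → ℂ
natℂ n = ofReal (fromℕ n)

open Derivation natℂ ℂᵣ.refl
  (λ n → ℂᵣ.trans (ofReal-cong (fromℕ-suc n)) (ofReal-⊕ 1ℝ (fromℕ n)))

ofReal-+ℝ : ∀ x y → ofReal (x +ℝ y) ≃ℂ ofReal x ⊞ ofReal y
ofReal-+ℝ x y = subst (λ w → ofReal w ≃ℂ ofReal x ⊞ ofReal y) (sym (+ℝ≡⊕ x y)) (ofReal-⊕ x y)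

ofReal-*ℝ : ∀ x y → ofReal (x *ℝ y) ≃ℂ ofReal x ⊠ ofReal y
ofReal-*ℝ x y = subst (λ w → ofReal w ≃ℂ ofReal x ⊠ ofReal y) (sym (*ℝ≡⊗ x y)) (ofReal-⊗ x y)

·ₚ-∷ : ∀ c a p → c ·ₚ (a ∷ p) ≡ (c *ℝ a) ∷ (c ·ₚ p)
·ₚ-∷ c a p = refl

-- Evaluation of polynomials and series

module _ (z : ℂ) where
  open ≃ℂ-Reasoning
  open ℂ-Solver

  evalℂ-∷ : ∀ a p → evalℂ (a ∷ p) z ≃ℂ ofReal a ⊞ z ⊠ evalℂ p z
  evalℂ-∷ a p = ℂᵣ.reflexive (trans (+ℂ≡⊞ (ofReal a) (z *ℂ evalℂ p z))
    (cong (ofReal a ⊞_) (*ℂ≡⊠ z (evalℂ p z))))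

  evalℂ-+ₚ : ∀ p q → evalℂ (p +ₚ q) z ≃ℂ evalℂ p z ⊞ evalℂ q z
  evalℂ-+ₚ []      q       = ℂᵣ.sym (ℂᵣ.+-identityˡ (evalℂ q z))
  evalℂ-+ₚ (a ∷ p) []      = ℂᵣ.sym (ℂᵣ.+-identityʳ (evalℂ (a ∷ p) z))
  evalℂ-+ₚ (a ∷ p) (b ∷ q) = begin
    evalℂ ((a +ℝ b) ∷ (p +ₚ q)) z
      ≈⟨ evalℂ-∷ (a +ℝ b) (p +ₚ q) ⟩
    ofReal (a +ℝ b) ⊞ z ⊠ evalℂ (p +ₚ q) z
      ≈⟨ ⊞-cong (ofReal-+ℝ a b)
                (ℂᵣ.*-congˡ {z} (evalℂ-+ₚ p q)) ⟩
    (ofReal a ⊞ ofReal b) ⊞ z ⊠ (evalℂ p z ⊞ evalℂ q z)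
      ≈⟨ solve 5 (λ z a b p q →
           (a :+ b) :+ z :* (p :+ q) := (a :+ z :* p) :+ (b :+ z :* q)) ℂᵣ.refl
           z (ofReal a) (ofReal b) (evalℂ p z) (evalℂ q z) ⟩
    (ofReal a ⊞ z ⊠ evalℂ p z) ⊞ (ofReal b ⊞ z ⊠ evalℂ q z)
      ≈⟨ ⊞-cong (evalℂ-∷ a p) (evalℂ-∷ b q) ⟨
    evalℂ (a ∷ p) z ⊞ evalℂ (b ∷ q) z ∎

  evalℂ-·ₚ-∷ : ∀ c a p →
    evalℂ (c ·ₚ (a ∷ p)) z ≃ℂ ofReal (c *ℝ a) ⊞ z ⊠ evalℂ (c ·ₚ p) z
  evalℂ-·ₚ-∷ c a p = subst (λ q → evalℂ q z ≃ℂ ofReal (c *ℝ a) ⊞ z ⊠ evalℂ (c ·ₚ p) z)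
    (sym (·ₚ-∷ c a p)) (evalℂ-∷ (c *ℝ a) (c ·ₚ p))

  evalℂ-·ₚ : ∀ c p → evalℂ (c ·ₚ p) z ≃ℂ ofReal c ⊠ evalℂ p z
  evalℂ-·ₚ c []      = ℂᵣ.sym (ℂᵣ.zeroʳ (ofReal c))
  evalℂ-·ₚ c (a ∷ p) = begin
    evalℂ (c ·ₚ (a ∷ p)) z
      ≈⟨ evalℂ-·ₚ-∷ c a p ⟩
    ofReal (c *ℝ a) ⊞ z ⊠ evalℂ (c ·ₚ p) z
      ≈⟨ ⊞-cong {ofReal (c *ℝ a)} {ofReal c ⊠ ofReal a} (ofReal-*ℝ c a)
                (ℂᵣ.*-congˡ {z} (evalℂ-·ₚ c p)) ⟩
    ofReal c ⊠ ofReal a ⊞ z ⊠ (ofReal c ⊠ evalℂ p z)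
      ≈⟨ solve 4 (λ z c a p → c :* a :+ z :* (c :* p) := c :* (a :+ z :* p)) ℂᵣ.refl
           z (ofReal c) (ofReal a) (evalℂ p z) ⟩
    ofReal c ⊠ (ofReal a ⊞ z ⊠ evalℂ p z)
      ≈⟨ ℂᵣ.*-congˡ {ofReal c} (evalℂ-∷ a p) ⟨
    ofReal c ⊠ evalℂ (a ∷ p) z ∎

  evalℂ-*ₚ : ∀ p q → evalℂ (p *ₚ q) z ≃ℂ evalℂ p z ⊠ evalℂ q z
  evalℂ-*ₚ []      q = ℂᵣ.sym (ℂᵣ.zeroˡ (evalℂ q z))
  evalℂ-*ₚ (a ∷ p) q = begin
    evalℂ ((a ·ₚ q) +ₚ (0ℝ ∷ (p *ₚ q))) z
      ≈⟨ evalℂ-+ₚ (a ·ₚ q) (0ℝ ∷ (p *ₚ q)) ⟩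
    evalℂ (a ·ₚ q) z ⊞ evalℂ (0ℝ ∷ (p *ₚ q)) z
      ≈⟨ ⊞-cong (evalℂ-·ₚ a q)
           (ℂᵣ.trans (evalℂ-∷ 0ℝ (p *ₚ q)) (ℂᵣ.+-congˡ {0ℂ} (ℂᵣ.*-congˡ {z} (evalℂ-*ₚ p q)))) ⟩
    ofReal a ⊠ evalℂ q z ⊞ (0ℂ ⊞ z ⊠ (evalℂ p z ⊠ evalℂ q z))
      ≈⟨ solve 4 (λ z a p q → a :* q :+ (con 0ℚ :+ z :* (p :* q)) := (a :+ z :* p) :* q) ℂᵣ.refl
           z (ofReal a) (evalℂ p z) (evalℂ q z) ⟩
    (ofReal a ⊞ z ⊠ evalℂ p z) ⊠ evalℂ q z
      ≈⟨ ℂᵣ.*-congʳ {evalℂ q z} (evalℂ-∷ a p) ⟨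
    evalℂ (a ∷ p) z ⊠ evalℂ q z ∎

  evalℂ-∑≤ : ∀ n f → evalℂ (∑≤ n f) z ≃ℂ ∑ n (λ k → evalℂ (f k) z)
  evalℂ-∑≤ zero    f = ℂᵣ.refl
  evalℂ-∑≤ (suc n) f = ℂᵣ.trans (evalℂ-+ₚ (∑≤ n f) (f (suc n)))
    (ℂᵣ.+-congʳ {evalℂ (f (suc n)) z} (evalℂ-∑≤ n f))

  evalℂ-constₚ : ∀ c → evalℂ (constₚ c) z ≃ℂ ofReal c
  evalℂ-constₚ c = ℂᵣ.trans (evalℂ-∷ c [])
    (solve 2 (λ z c → c :+ z :* con 0ℚ := c) ℂᵣ.refl z (ofReal c))

  evalℂ-X : evalℂ X z ≃ℂ z
  evalℂ-X = ℂᵣ.trans (evalℂ-∷ 0ℝ (1ℝ ∷ []))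
    (ℂᵣ.trans (ℂᵣ.+-congˡ {0ℂ} (ℂᵣ.*-congˡ {z} (evalℂ-constₚ 1ℝ)))
      (solve 1 (λ z → con 0ℚ :+ z :* con 1ℚ := z) ℂᵣ.refl z))

  -- Lists of coefficients with trailing zeros have no canonical form, so identities between series
  -- over ℝ[x] are stated after evaluation at a fixed complex `z`.
  evalₛ : Series → ℕ → ℂ
  evalₛ f n = evalℂ (f n) z

  evalₛ-*ₛ : ∀ f g n → evalₛ (f *ₛ g) n ≃ℂ (evalₛ f ⋆ evalₛ g) n
  evalₛ-*ₛ f g n = ℂᵣ.trans (evalℂ-∑≤ n (λ k → f k *ₚ g (n ∸ k)))
    (∑-cong n λ k → evalℂ-*ₚ (f k) (g (n ∸ k)))

  evalₛ-1ₛ : ∀ n → evalₛ 1ₛ n ≃ℂ δ n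
  evalₛ-1ₛ zero    = evalℂ-constₚ 1ℝ
  evalₛ-1ₛ (suc n) = ℂᵣ.refl

  evalₛ-^ₛ : ∀ u k n → evalₛ (u ^ₛ k) n ≃ℂ power (evalₛ u) k n
  evalₛ-^ₛ u zero    n = evalₛ-1ₛ n
  evalₛ-^ₛ u (suc k) n = ℂᵣ.trans (evalₛ-*ₛ u (u ^ₛ k) n)
    (⋆-cong {evalₛ u} {evalₛ u} (λ _ → ℂᵣ.refl) (evalₛ-^ₛ u k) n)

  evalₛ-expₛ : ∀ u n →
    evalₛ (expₛ u) n ≃ℂ ∑ n (λ k → ofReal (1/fact k) ⊠ power (evalₛ u) k n)
  evalₛ-expₛ u n = ℂᵣ.trans (evalℂ-∑≤ n (λ k → 1/fact k ·ₚ (u ^ₛ k) n))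
    (∑-cong n λ k → ℂᵣ.trans (evalℂ-·ₚ (1/fact k) ((u ^ₛ k) n))
      (ℂᵣ.*-congˡ {ofReal (1/fact k)} (evalₛ-^ₛ u k n)))

  evalₛ-X·ₛ : ∀ f n → evalₛ (X ·ₛ f) n ≃ℂ z ⊠ evalₛ f n
  evalₛ-X·ₛ f n = ℂᵣ.trans (evalℂ-*ₚ X (f n)) (ℂᵣ.*-congʳ {evalₛ f n} evalℂ-X)

  evalₛ--ₛ : ∀ f g n → evalₛ (f -ₛ g) n ≃ℂ evalₛ f n ⊞ ⊟ evalₛ g n
  evalₛ--ₛ f g n = begin
    evalℂ (f n +ₚ ((-ℝ 1ℝ) ·ₚ g n)) z
      ≈⟨ evalℂ-+ₚ (f n) ((-ℝ 1ℝ) ·ₚ g n) ⟩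
    evalₛ f n ⊞ evalℂ ((-ℝ 1ℝ) ·ₚ g n) z
      ≈⟨ ℂᵣ.+-congˡ {evalₛ f n} (evalℂ-·ₚ (-ℝ 1ℝ) (g n)) ⟩
    evalₛ f n ⊞ ofReal (-ℝ 1ℝ) ⊠ evalₛ g n
      ≈⟨ ℂᵣ.+-congˡ {evalₛ f n} (ℂᵣ.*-congʳ {evalₛ g n}
           (ℂᵣ.trans (ℂᵣ.reflexive (cong ofReal (-ℝ≡⊖ 1ℝ))) (ofReal-⊖ 1ℝ))) ⟩
    evalₛ f n ⊞ ⊟ 1ℂ ⊠ evalₛ g n
      ≈⟨ solve 2 (λ x y → x :+ :- con 1ℚ :* y := x :+ :- y) ℂᵣ.refl (evalₛ f n) (evalₛ g n) ⟩
    evalₛ f n ⊞ ⊟ evalₛ g n ∎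

-- The series (1 - t)^γ and the coefficients of P

binomialSeries : ℝ → ℕ → ℝ
binomialSeries γ k = binomial γ k *ℝ sign k

sign-suc : ∀ n → sign (suc n) ≡ ⊖ sign n
sign-suc n = -ℝ≡⊖ (sign n)

fallingFactorial-suc : ∀ γ n →
  fallingFactorial γ (suc n) ≡ fallingFactorial γ n ⊗ (γ ⊕ ⊖ fromℕ n)
fallingFactorial-suc γ n = trans (*ℝ≡⊗ (fallingFactorial γ n) (γ -ℝ fromℕ n))
  (cong (fallingFactorial γ n ⊗_) (x-ℝy≡x⊕⊖y γ (fromℕ n)))

binomialSeries-expand : ∀ γ n →
  binomialSeries γ n ≡ (1/fact n ⊗ fallingFactorial γ n) ⊗ sign n
binomialSeries-expand γ n = trans (*ℝ≡⊗ (binomial γ n) (sign n))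
  (cong (_⊗ sign n) (*ℝ≡⊗ (1/fact n) (fallingFactorial γ n)))

-- Consecutive coefficients satisfy (n + 1) cₙ₊₁ = (n - γ) cₙ, arranged here as (1 - t) f′ = - γ f.
-- The change of sign turns the new factor γ - n into n - γ.
binomialSeries-suc : ∀ γ n →
  fromℕ (suc n) ⊗ binomialSeries γ (suc n) ≃
  fromℕ n ⊗ binomialSeries γ n ⊕ ⊖ γ ⊗ binomialSeries γ n
binomialSeries-suc γ n = begin
  N ⊗ binomialSeries γ (suc n)
    ≡⟨ cong (N ⊗_) expandˢ ⟩
  N ⊗ ((I ⊗ (F ⊗ (γ ⊕ ⊖ fromℕ n))) ⊗ ⊖ σ)
    ≈⟨ solve 6 (λ N I F γ n σ → N :* ((I :* (F :* (γ :+ :- n))) :* :- σ) :=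
         n :* (((N :* I) :* F) :* σ) :+ :- γ :* (((N :* I) :* F) :* σ))
         ≃-refl N I F γ (fromℕ n) σ ⟩
  fromℕ n ⊗ (((N ⊗ I) ⊗ F) ⊗ σ) ⊕ ⊖ γ ⊗ (((N ⊗ I) ⊗ F) ⊗ σ)
    ≈⟨ ⊕-cong (⊗-cong ≃-refl contract) (⊗-cong ≃-refl contract) ⟩
  fromℕ n ⊗ binomialSeries γ n ⊕ ⊖ γ ⊗ binomialSeries γ n ∎
  where
  open ≃-Reasoning
  open ℝ-Solver
  N = fromℕ (suc n) ; I = 1/fact (suc n) ; F = fallingFactorial γ n ; σ = sign n

  expandˢ : binomialSeries γ (suc n) ≡ (I ⊗ (F ⊗ (γ ⊕ ⊖ fromℕ n))) ⊗ ⊖ σ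
  expandˢ = trans (binomialSeries-expand γ (suc n)) (cong₂ _⊗_
    (cong (I ⊗_) (fallingFactorial-suc γ n)) (sign-suc n))

  contract : ((N ⊗ I) ⊗ F) ⊗ σ ≃ binomialSeries γ n
  contract = ≃-trans (⊗-cong (⊗-cong (1/fact-suc n) ≃-refl) ≃-refl)
    (CommutativeRing.reflexive ℝ-commutativeRing (sym (binomialSeries-expand γ n)))

binomialSeries-0 : ∀ γ → binomialSeries γ 0 ≃ 1ℝ
binomialSeries-0 γ = begin
  binomialSeries γ 0      ≡⟨ binomialSeries-expand γ 0 ⟩
  (1/fact 0 ⊗ 1ℝ) ⊗ 1ℝ    ≈⟨ ≃-trans (⊗-identityʳ (1/fact 0 ⊗ 1ℝ)) (⊗-identityʳ (1/fact 0)) ⟩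
  1/fact 0                ≈⟨ fromℚ-cong refl ⟩
  1ℝ                      ∎
  where open ≃-Reasoning

binomialℂ : ℝ → ℕ → ℂ
binomialℂ γ n = ofReal (binomialSeries γ n)

binomialℂ-solves : ∀ γ → binomialℂ γ Solves (λ n → ofReal (⊖ γ) ⊠ binomialℂ γ n)
binomialℂ-solves γ n = begin
  natℂ (suc n) ⊠ binomialℂ γ (suc n)
    ≈⟨ ofReal-⊗ (fromℕ (suc n)) (binomialSeries γ (suc n)) ⟨
  ofReal (fromℕ (suc n) ⊗ binomialSeries γ (suc n))
    ≈⟨ ofReal-cong (binomialSeries-suc γ n) ⟩
  ofReal (fromℕ n ⊗ binomialSeries γ n ⊕ ⊖ γ ⊗ binomialSeries γ n)
    ≈⟨ ofReal-⊕ (fromℕ n ⊗ binomialSeries γ n) (⊖ γ ⊗ binomialSeries γ n) ⟩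
  ofReal (fromℕ n ⊗ binomialSeries γ n) ⊞ ofReal (⊖ γ ⊗ binomialSeries γ n)
    ≈⟨ ⊞-cong (ofReal-⊗ (fromℕ n) (binomialSeries γ n)) (ofReal-⊗ (⊖ γ) (binomialSeries γ n)) ⟩
  natℂ n ⊠ binomialℂ γ n ⊞ ofReal (⊖ γ) ⊠ binomialℂ γ n ∎
  where open ≃ℂ-Reasoning

[1-t]^-const : ∀ γ n → ([1-t]^ γ) n ≡ constₚ (binomialSeries γ n)
[1-t]^-const γ n = refl

evalₛ-[1-t]^ : ∀ z γ n → evalₛ z ([1-t]^ γ) n ≃ℂ binomialℂ γ n
evalₛ-[1-t]^ z γ n = subst (λ p → evalℂ p z ≃ℂ binomialℂ γ n) (sym ([1-t]^-const γ n))
  (evalℂ-constₚ z (binomialSeries γ n))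

exponent : ℝ → ℕ → ℂ
exponent β n = binomialℂ β n ⊞ ⊟ δ n

exponent-0 : ∀ β → exponent β 0 ≃ℂ 0ℂ
exponent-0 β = ℂᵣ.trans (ℂᵣ.+-congʳ {⊟ 1ℂ} (ofReal-cong (binomialSeries-0 β))) (ℂᵣ.-‿inverseʳ 1ℂ)

-- Subtracting 1 does not change the derivative, and the right side - β (1 - t)^β becomes - β (u +
-- 1).
exponent-solves : ∀ β → exponent β Solves (λ n → ofReal (⊖ β) ⊠ (exponent β n ⊞ δ n))
exponent-solves β n = begin
  natℂ (suc n) ⊠ (g (suc n) ⊞ ⊟ 0ℂ)
    ≈⟨ solve 2 (λ m x → m :* (x :+ :- con 0ℚ) := m :* x) ℂᵣ.refl (natℂ (suc n)) (g (suc n)) ⟩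
  natℂ (suc n) ⊠ g (suc n)
    ≈⟨ binomialℂ-solves β n ⟩
  natℂ n ⊠ g n ⊞ b ⊠ g n
    ≈⟨ solve 4 (λ m x b d → m :* x :+ b :* x :=
         (m :* (x :+ :- d) :+ b :* ((x :+ :- d) :+ d)) :+ m :* d) ℂᵣ.refl (natℂ n) (g n) b (δ n) ⟩
  (natℂ n ⊠ exponent β n ⊞ b ⊠ (exponent β n ⊞ δ n)) ⊞ euler δ n
    ≈⟨ ℂᵣ.+-congˡ {natℂ n ⊠ exponent β n ⊞ b ⊠ (exponent β n ⊞ δ n)} (euler-δ n) ⟩
  (natℂ n ⊠ exponent β n ⊞ b ⊠ (exponent β n ⊞ δ n)) ⊞ 0ℂ
    ≈⟨ ℂᵣ.+-identityʳ (natℂ n ⊠ exponent β n ⊞ b ⊠ (exponent β n ⊞ δ n)) ⟩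
  natℂ n ⊠ exponent β n ⊞ b ⊠ (exponent β n ⊞ δ n) ∎
  where
  open ≃ℂ-Reasoning
  open ℂ-Solver
  g = binomialℂ β
  b = ofReal (⊖ β)

factℂ-suc : ∀ n → natℂ (suc n !) ≃ℂ natℂ (suc n) ⊠ natℂ (n !)
factℂ-suc n = ℂᵣ.trans (ofReal-cong (fromℕ-* (suc n) (n !))) (ofReal-⊗ (fromℕ (suc n)) (fromℕ (n !)))

1/factℂ-suc : ∀ k → natℂ (suc k) ⊠ ofReal (1/fact (suc k)) ≃ℂ ofReal (1/fact k)
1/factℂ-suc k = ℂᵣ.trans (ℂᵣ.sym (ofReal-⊗ (fromℕ (suc k)) (1/fact (suc k))))
  (ofReal-cong (1/fact-suc k))

module _ (α β : ℝ) where
  private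
    b = ofReal (⊖ β)
    a = ofReal (⊖ α)

  coeffP : ℕ → ℕ → ℂ
  coeffP = coefficient {exponent β} {b} (exponent-solves β) {binomialℂ α} {a} (binomialℂ-solves α)
    factℂ-suc 1/factℂ-suc

  coeffP-suc-zero : ∀ n → coeffP (suc n) 0 ≃ℂ (natℂ n ⊞ a) ⊠ coeffP n 0
  coeffP-suc-zero = coefficient-suc-zero {exponent β} {b} (exponent-solves β)
    {binomialℂ α} {a} (binomialℂ-solves α) factℂ-suc 1/factℂ-suc

  coeffP-suc-suc : ∀ n k → coeffP (suc n) (suc k) ≃ℂ
    (natℂ n ⊞ a) ⊠ coeffP n (suc k) ⊞ b ⊠ (coeffP n k ⊞ natℂ (suc k) ⊠ coeffP n (suc k))
  coeffP-suc-suc = coefficient-suc-suc {exponent β} {b} (exponent-solves β)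
    {binomialℂ α} {a} (binomialℂ-solves α) factℂ-suc 1/factℂ-suc

  coeffP-0-0 : coeffP 0 0 ≃ℂ 1ℂ
  coeffP-0-0 = begin
    natℂ 1 ⊠ (ofReal (1/fact 0) ⊠ (binomialℂ α 0 ⊠ 1ℂ))
      ≈⟨ ⊠-cong (ofReal-cong (fromℚ-cong refl)) (⊠-cong (ofReal-cong (fromℚ-cong refl))
           (⊠-cong (ofReal-cong (binomialSeries-0 α)) (ℂᵣ.refl {1ℂ}))) ⟩
    1ℂ ⊠ (1ℂ ⊠ (1ℂ ⊠ 1ℂ))
      ≈⟨ solve 0 (con 1ℚ :* (con 1ℚ :* (con 1ℚ :* con 1ℚ)) := con 1ℚ) ℂᵣ.refl ⟩
    1ℂ ∎
    where
    open ≃ℂ-Reasoning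
    open ℂ-Solver

  coeffP-0-suc : ∀ k → coeffP 0 (suc k) ≃ℂ 0ℂ
  coeffP-0-suc k = begin
    natℂ 1 ⊠ (ofReal (1/fact (suc k)) ⊠ (binomialℂ α 0 ⊠ power (exponent β) (suc k) 0))
      ≈⟨ ℂᵣ.*-congˡ {natℂ 1} (ℂᵣ.*-congˡ {ofReal (1/fact (suc k))} (ℂᵣ.*-congˡ {binomialℂ α 0}
           (power-vanish (exponent β) (exponent-0 β) (suc k) 0 (s≤s z≤n)))) ⟩
    natℂ 1 ⊠ (ofReal (1/fact (suc k)) ⊠ (binomialℂ α 0 ⊠ 0ℂ))
      ≈⟨ solve 3 (λ x y w → x :* (y :* (w :* con 0ℚ)) := con 0ℚ) ℂᵣ.refl
           (natℂ 1) (ofReal (1/fact (suc k))) (binomialℂ α 0) ⟩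
    0ℂ ∎
    where
    open ≃ℂ-Reasoning
    open ℂ-Solver

  evalℂ-P : ∀ n z → evalℂ (P α β n) z ≃ℂ ∑ n (λ k → coeffP n k ⊠ scalarPower z k)
  evalℂ-P n z = begin
    evalℂ (fromℕ (n !) ·ₚ generatingFunction α β n) z
      ≈⟨ evalℂ-·ₚ z (fromℕ (n !)) (generatingFunction α β n) ⟩
    natℂ (n !) ⊠ evalₛ z (generatingFunction α β) n
      ≈⟨ ℂᵣ.*-congˡ {natℂ (n !)} (ℂᵣ.trans (evalₛ-*ₛ z ([1-t]^ α) (expₛ v) n)
           (⋆-cong {evalₛ z ([1-t]^ α)} {binomialℂ α} (evalₛ-[1-t]^ z α)
             exp n)) ⟩
    natℂ (n !) ⊠
      (binomialℂ α ⋆ (λ m → ∑ m λ k → ofReal (1/fact k) ⊠ power (λ i → z ⊠ exponent β i) k m)) n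
      ≈⟨ generating-expansion {exponent β} {b} (exponent-solves β) {binomialℂ α} {a}
           (binomialℂ-solves α) factℂ-suc 1/factℂ-suc (exponent-0 β) z n ⟩
    ∑ n (λ k → coeffP n k ⊠ scalarPower z k) ∎
    where
    open ≃ℂ-Reasoning
    v : Series
    v = X ·ₛ (([1-t]^ β) -ₛ 1ₛ)

    eval-v : ∀ m → evalₛ z v m ≃ℂ z ⊠ exponent β m
    eval-v m = begin
      evalₛ z v m
        ≈⟨ evalₛ-X·ₛ z (([1-t]^ β) -ₛ 1ₛ) m ⟩
      z ⊠ evalₛ z (([1-t]^ β) -ₛ 1ₛ) m
        ≈⟨ ℂᵣ.*-congˡ {z} {evalₛ z (([1-t]^ β) -ₛ 1ₛ) m}
             {evalₛ z ([1-t]^ β) m ⊞ ⊟ evalₛ z 1ₛ m} (evalₛ--ₛ z ([1-t]^ β) 1ₛ m) ⟩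
      z ⊠ (evalₛ z ([1-t]^ β) m ⊞ ⊟ evalₛ z 1ₛ m)
        ≈⟨ ℂᵣ.*-congˡ {z} {evalₛ z ([1-t]^ β) m ⊞ ⊟ evalₛ z 1ₛ m} {binomialℂ β m ⊞ ⊟ δ m}
             (⊞-cong {evalₛ z ([1-t]^ β) m} {binomialℂ β m} {⊟ evalₛ z 1ₛ m} {⊟ δ m}
               (evalₛ-[1-t]^ z β m)
               (ℂᵣ.-‿cong {evalₛ z 1ₛ m} {δ m} (evalₛ-1ₛ z m))) ⟩
      z ⊠ exponent β m ∎

    exp : ∀ m → evalₛ z (expₛ v) m ≃ℂ
      ∑ m (λ k → ofReal (1/fact k) ⊠ power (λ i → z ⊠ exponent β i) k m)
    exp m = ℂᵣ.trans (evalₛ-expₛ z v m) (∑-cong m λ k →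
      ℂᵣ.*-congˡ {ofReal (1/fact k)} (power-cong {evalₛ z v} eval-v k m))

-- The restriction to the diagonal

coeff : ∀ {n} → MultiAffine n → ℕ → ℂ
coeff (const a)  zero    = a
coeff (const a)  (suc k) = 0ℂ
coeff (A +x· B) zero    = coeff A 0
coeff (A +x· B) (suc k) = coeff A (suc k) ⊞ coeff B k

coeff-vanish : ∀ {n} (F : MultiAffine n) k → n ℕ.< k → coeff F k ≃ℂ 0ℂ
coeff-vanish (const a)  (suc k) _         = ℂᵣ.refl
coeff-vanish (A +x· B) (suc k) (s≤s n<k) = ℂᵣ.trans
  (⊞-cong (coeff-vanish A (suc k) (ℕₚ.m≤n⇒m≤1+n n<k)) (coeff-vanish B k n<k)) (ℂᵣ.+-identityˡ 0ℂ)

module _ where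
  open ≃ℂ-Reasoning
  open ℂ-Solver

  coeff-+ₘ : ∀ {n} (F G : MultiAffine n) k → coeff (F +ₘ G) k ≃ℂ coeff F k ⊞ coeff G k
  coeff-+ₘ (const a)  (const b)  zero    = ℂᵣ.refl
  coeff-+ₘ (const a)  (const b)  (suc k) = ℂᵣ.sym (ℂᵣ.+-identityˡ 0ℂ)
  coeff-+ₘ (A +x· B) (C +x· E) zero    = coeff-+ₘ A C 0
  coeff-+ₘ (A +x· B) (C +x· E) (suc k) = ℂᵣ.trans
    (⊞-cong (coeff-+ₘ A C (suc k)) (coeff-+ₘ B E k))
    (solve 4 (λ a b c e → (a :+ c) :+ (b :+ e) := (a :+ b) :+ (c :+ e)) ℂᵣ.refl
      (coeff A (suc k)) (coeff B k) (coeff C (suc k)) (coeff E k))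

  coeff-·ₘ : ∀ {n} c (F : MultiAffine n) k → coeff (c ·ₘ F) k ≃ℂ c ⊠ coeff F k
  coeff-·ₘ c (const a)  zero    = ℂᵣ.refl
  coeff-·ₘ c (const a)  (suc k) = ℂᵣ.sym (ℂᵣ.zeroʳ c)
  coeff-·ₘ c (A +x· B) zero    = coeff-·ₘ c A 0
  coeff-·ₘ c (A +x· B) (suc k) = ℂᵣ.trans
    (⊞-cong (coeff-·ₘ c A (suc k)) (coeff-·ₘ c B k))
    (ℂᵣ.sym (ℂᵣ.distribˡ c (coeff A (suc k)) (coeff B k)))

  natℂ-suc : ∀ n → natℂ (suc n) ≃ℂ 1ℂ ⊞ natℂ n
  natℂ-suc n = ℂᵣ.trans (ofReal-cong (fromℕ-suc n)) (ofReal-⊕ 1ℝ (fromℕ n))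

  -- The chain rule: the derivative of F(x, ..., x) is the sum of all partial derivatives on the
  -- diagonal.
  coeff-∂ : ∀ {n} (F : MultiAffine n) k → coeff (∂ F) k ≃ℂ natℂ (suc k) ⊠ coeff F (suc k)
  coeff-∂ (const a)  zero    = ℂᵣ.sym (ℂᵣ.zeroʳ (natℂ 1))
  coeff-∂ (const a)  (suc k) = ℂᵣ.sym (ℂᵣ.zeroʳ (natℂ (suc (suc k))))
  coeff-∂ (A +x· B) zero    = begin
    coeff (∂ A +ₘ B) 0
      ≈⟨ coeff-+ₘ (∂ A) B 0 ⟩
    coeff (∂ A) 0 ⊞ coeff B 0
      ≈⟨ ℂᵣ.+-congʳ {coeff B 0} (coeff-∂ A 0) ⟩
    natℂ 1 ⊠ coeff A 1 ⊞ coeff B 0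
      ≈⟨ solve 2 (λ a b → con 1ℚ :* a :+ b := con 1ℚ :* (a :+ b)) ℂᵣ.refl (coeff A 1) (coeff B 0) ⟩
    natℂ 1 ⊠ (coeff A 1 ⊞ coeff B 0) ∎
  coeff-∂ (A +x· B) (suc k) = begin
    coeff (∂ A +ₘ B) (suc k) ⊞ coeff (∂ B) k
      ≈⟨ ⊞-cong (ℂᵣ.trans (coeff-+ₘ (∂ A) B (suc k))
           (ℂᵣ.+-congʳ {b} (ℂᵣ.trans (coeff-∂ A (suc k))
             (ℂᵣ.*-congʳ {a} (natℂ-suc (suc k))))))
           (coeff-∂ B k) ⟩
    ((1ℂ ⊞ natℂ (suc k)) ⊠ a ⊞ b) ⊞ natℂ (suc k) ⊠ b
      ≈⟨ solve 3 (λ m a b → ((con 1ℚ :+ m) :* a :+ b) :+ m :* b := (con 1ℚ :+ m) :* (a :+ b))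
           ℂᵣ.refl (natℂ (suc k)) a b ⟩
    (1ℂ ⊞ natℂ (suc k)) ⊠ (a ⊞ b)
      ≈⟨ ℂᵣ.*-congʳ {a ⊞ b} (natℂ-suc (suc k)) ⟨
    natℂ (suc (suc k)) ⊠ (a ⊞ b) ∎
    where
    a = coeff A (suc (suc k)) ; b = coeff B (suc k)

  coeff-step-suc : ∀ {n} c b (F : MultiAffine n) k → coeff (step c b F) (suc k) ≃ℂ
    ofReal c ⊠ coeff F (suc k) ⊞ ofReal b ⊠ (coeff F k ⊞ natℂ (suc k) ⊠ coeff F (suc k))
  coeff-step-suc c b F k = ⊞-cong (coeff-·ₘ (ofReal c) F (suc k))
    (ℂᵣ.trans (coeff-·ₘ (ofReal b) (F +ₘ ∂ F) k)
      (ℂᵣ.*-congˡ {ofReal b} (ℂᵣ.trans (coeff-+ₘ F (∂ F) k) (ℂᵣ.+-congˡ {coeff F k} (coeff-∂ F k)))))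

  diagonal : ∀ n → ℂ → Point n
  diagonal n z = replicate n (z , 1ℂ)

  eval-diagonal : ∀ {n} (F : MultiAffine n) z →
    eval F (diagonal n z) ≃ℂ ∑ n (λ k → coeff F k ⊠ scalarPower z k)
  eval-diagonal (const a)  z = ℂᵣ.sym (ℂᵣ.*-identityʳ a)
  eval-diagonal {suc n} (A +x· B) z = begin
    1ℂ ⊠ eval A (diagonal n z) ⊞ z ⊠ eval B (diagonal n z)
      ≈⟨ ⊞-cong (ℂᵣ.trans (ℂᵣ.*-identityˡ (eval A (diagonal n z))) (eval-diagonal A z))
                (ℂᵣ.*-congˡ {z} (eval-diagonal B z)) ⟩
    ∑ n p ⊞ z ⊠ ∑ n (λ k → coeff B k ⊠ scalarPower z k)
      ≈⟨ ⊞-cong (∑-extend n (suc n) {p} (ℕₚ.n≤1+n n) λ k n<k → ℂᵣ.trans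
             (ℂᵣ.*-congʳ {scalarPower z k} (coeff-vanish A k n<k)) (ℂᵣ.zeroˡ (scalarPower z k)))
           (ℂᵣ.trans (ℂᵣ.sym (∑-* n z (λ k → coeff B k ⊠ scalarPower z k)))
             (∑-cong n λ k → solve 3 (λ z b w → z :* (b :* w) := b :* (z :* w)) ℂᵣ.refl
               z (coeff B k) (scalarPower z k))) ⟩
    ∑ (suc n) p ⊞ ∑ n q
      ≈⟨ ℂᵣ.+-congʳ {∑ n q} (∑-head n p) ⟩
    (p 0 ⊞ ∑ n (λ k → p (suc k))) ⊞ ∑ n q
      ≈⟨ ℂᵣ.+-assoc (p 0) (∑ n (λ k → p (suc k))) (∑ n q) ⟩
    p 0 ⊞ (∑ n (λ k → p (suc k)) ⊞ ∑ n q)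
      ≈⟨ ℂᵣ.+-congˡ {p 0} (∑-+ n (λ k → p (suc k)) q) ⟨
    p 0 ⊞ ∑ n (λ k → p (suc k) ⊞ q k)
      ≈⟨ ℂᵣ.+-congˡ {p 0} (∑-cong n λ k →
           ℂᵣ.sym (ℂᵣ.distribʳ (scalarPower z (suc k)) (coeff A (suc k)) (coeff B k))) ⟩
    r 0 ⊞ ∑ n (λ k → r (suc k))
      ≈⟨ ∑-head n r ⟨
    ∑ (suc n) r ∎
    where
    p q r : ℕ → ℂ
    p k = coeff A k ⊠ scalarPower z k
    q k = coeff B k ⊠ scalarPower z (suc k)
    r k = coeff (A +x· B) k ⊠ scalarPower z k

-- Reduction to the upper half-plane

conj : ℂ → ℂ
conj z = re z +i (⊖ im z)

module _ where
  open ≃ℂ-Reasoning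

  conj-cong : ∀ {z w} → z ≃ℂ w → conj z ≃ℂ conj w
  conj-cong (p , q) = p , ⊖-cong q

  conj-⊠ : ∀ z w → conj z ⊠ conj w ≃ℂ conj (z ⊠ w)
  conj-⊠ (a +i b) (c +i d) =
    solve 4 (λ a b c d → a :* c :+ :- (:- b :* :- d) := a :* c :+ :- (b :* d)) ≃-refl a b c d ,
    solve 4 (λ a b c d → a :* :- d :+ :- b :* c := :- (a :* d :+ b :* c)) ≃-refl a b c d
    where open ℝ-Solver

  conj-ofReal-⊞ : ∀ a z → ofReal a ⊞ conj z ≃ℂ conj (ofReal a ⊞ z)
  conj-ofReal-⊞ a (c +i d) =
    ≃-refl , solve 1 (λ d → con 0ℚ :+ :- d := :- (con 0ℚ :+ d)) ≃-refl d
    where open ℝ-Solver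

  evalℂ-conj : ∀ p z → evalℂ p (conj z) ≃ℂ conj (evalℂ p z)
  evalℂ-conj []      z = ≃-refl , ≃-sym (⊖-zero ≃-refl)
  evalℂ-conj (a ∷ p) z = begin
    evalℂ (a ∷ p) (conj z)
      ≈⟨ evalℂ-∷ (conj z) a p ⟩
    ofReal a ⊞ conj z ⊠ evalℂ p (conj z)
      ≈⟨ ℂᵣ.+-congˡ {ofReal a} (ℂᵣ.trans (ℂᵣ.*-congˡ {conj z} (evalℂ-conj p z))
           (conj-⊠ z (evalℂ p z))) ⟩
    ofReal a ⊞ conj (z ⊠ evalℂ p z)
      ≈⟨ conj-ofReal-⊞ a (z ⊠ evalℂ p z) ⟩
    conj (ofReal a ⊞ z ⊠ evalℂ p z)
      ≈⟨ conj-cong {evalℂ (a ∷ p) z} {ofReal a ⊞ z ⊠ evalℂ p z} (evalℂ-∷ z a p) ⟨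
    conj (evalℂ (a ∷ p) z) ∎

-- The coefficients are real, so a zero in the lower half-plane reflects to one in the upper; with
-- both signs of the imaginary part refuted, it is 0.
noUpperZeros⇒onlyRealZeros : ∀ p →
  (∀ z → 0ℝ <ℝ im z → ¬ (evalℂ p z ≃ℂ 0ℂ)) → HasOnlyRealZeros p
noUpperZeros⇒onlyRealZeros p noUpper z pz≃0 = ¬pos∧¬neg⇒≃0
  (λ 0<im → noUpper z 0<im pz≃0)
  (λ 0<-im → noUpper (conj z) 0<-im (ℂᵣ.trans (evalℂ-conj p z)
    (ℂᵣ.trans (conj-cong {evalℂ p z} {0ℂ} pz≃0) (≃-refl , ⊖-zero ≃-refl))))

0<im⇒upper : ∀ n z → 0ℝ <ℝ im z → Upper (diagonal n z)
0<im⇒upper zero    z 0<im = []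
0<im⇒upper (suc n) z 0<im = pos-resp-≃
  (solve 2 (λ a b → b := b :* con 1ℚ :+ :- (a :* con 0ℚ)) ≃-refl (re z) (im z)) 0<im
  ∷ 0<im⇒upper n z 0<im
  where open ℝ-Solver

-- Stable multi-affine lifts of P

slope : ℝ → ℕ → ℝ
slope α n = fromℕ n ⊕ ⊖ α

module _ (α β : ℝ) where
  -- Only the diagonal is constrained, so a lift is not unique. All `k` are included, which lets the
  -- recurrence at k + 1 be used without a bound on the degree.
  Lifts : ∀ {n} → MultiAffine n → Set
  Lifts {n} F = ∀ k → coeff F k ≃ℂ coeffP α β n k

  -- The index is shifted: `StableLift m` concerns P of index m + 1, since `StronglyStable` refers
  -- to a first variable.
  StableLift : ℕ → Set
  StableLift m = ∃ λ (F : MultiAffine (suc m)) → StronglyStable F × Lifts F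

  lift₀ : MultiAffine 0
  lift₀ = const 1ℂ

  lifts₀ : Lifts lift₀
  lifts₀ zero    = ℂᵣ.sym (coeffP-0-0 α β)
  lifts₀ (suc k) = ℂᵣ.sym (coeffP-0-suc α β k)

  step-lifts : ∀ {n} (F : MultiAffine n) → Lifts F → Lifts (step (slope α n) (⊖ β) F)
  step-lifts {n} F lifts zero = begin
    coeff (ofReal (slope α n) ·ₘ F) 0
      ≈⟨ coeff-·ₘ (ofReal (slope α n)) F 0 ⟩
    ofReal (slope α n) ⊠ coeff F 0
      ≈⟨ ⊠-cong (ofReal-⊕ (fromℕ n) (⊖ α)) (lifts 0) ⟩
    (natℂ n ⊞ ofReal (⊖ α)) ⊠ coeffP α β n 0
      ≈⟨ coeffP-suc-zero α β n ⟨
    coeffP α β (suc n) 0 ∎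
    where open ≃ℂ-Reasoning
  step-lifts {n} F lifts (suc k) = begin
    coeff (step (slope α n) (⊖ β) F) (suc k)
      ≈⟨ coeff-step-suc (slope α n) (⊖ β) F k ⟩
    ofReal (slope α n) ⊠ coeff F (suc k)
      ⊞ ofReal (⊖ β) ⊠ (coeff F k ⊞ natℂ (suc k) ⊠ coeff F (suc k))
      ≈⟨ ⊞-cong (⊠-cong (ofReal-⊕ (fromℕ n) (⊖ α)) (lifts (suc k)))
           (ℂᵣ.*-congˡ {ofReal (⊖ β)} (⊞-cong (lifts k)
             (ℂᵣ.*-congˡ {natℂ (suc k)} (lifts (suc k))))) ⟩
    (natℂ n ⊞ ofReal (⊖ α)) ⊠ coeffP α β n (suc k)
      ⊞ ofReal (⊖ β) ⊠ (coeffP α β n k ⊞ natℂ (suc k) ⊠ coeffP α β n (suc k))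
      ≈⟨ coeffP-suc-suc α β n k ⟨
    coeffP α β (suc n) (suc k) ∎
    where open ≃ℂ-Reasoning

  lift₁ : MultiAffine 1
  lift₁ = step (slope α 0) (⊖ β) lift₀

  lifts₁ : Lifts lift₁
  lifts₁ = step-lifts lift₀ lifts₀

  stableLift⇒onlyRealZeros : ∀ {m} → StableLift m → HasOnlyRealZeros (P α β (suc m))
  stableLift⇒onlyRealZeros {m} (F@(_ +x· _) , (stable , _) , lifts) =
    noUpperZeros⇒onlyRealZeros (P α β (suc m)) λ z 0<im Pz≃0 →
      stable (diagonal (suc m) z) (0<im⇒upper (suc m) z 0<im) (begin
        eval F (diagonal (suc m) z)
          ≈⟨ eval-diagonal F z ⟩
        ∑ (suc m) (λ k → coeff F k ⊠ scalarPower z k)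
          ≈⟨ ∑-cong (suc m) (λ k → ℂᵣ.*-congʳ {scalarPower z k} (lifts k)) ⟩
        ∑ (suc m) (λ k → coeffP α β (suc m) k ⊠ scalarPower z k)
          ≈⟨ evalℂ-P α β (suc m) z ⟨
        evalℂ (P α β (suc m)) z
          ≈⟨ Pz≃0 ⟩
        0ℂ ∎)
    where open ≃ℂ-Reasoning

  module _ (0<b² : 0ℝ <ℝ ⊖ β ⊗ ⊖ β) where

    stableLift-suc : ∀ {m} → 0ℝ ≤ℝ slope α (suc m) ⊗ ⊖ β → StableLift m → StableLift (suc m)
    stableLift-suc {m} 0≤cb (F , stable , lifts) = step (slope α (suc m)) (⊖ β) F ,
      step-stronglyStable F 0≤cb 0<b² stable , step-lifts F lifts

    private
      b = ofReal (⊖ β)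
      c = ofReal (slope α 0)

      b≄0 : ¬ (b ⊠ (1ℂ ⊞ 0ℂ) ≃ℂ 0ℂ)
      b≄0 b≃0 = pos⇒≄0 0<b² (⊗-zeroˡ (⊖ β) (proj₁
        (ℂᵣ.trans (solve 1 (λ b → b := b :* (con 1ℚ :+ con 0ℚ)) ℂᵣ.refl b) b≃0)))
        where open ℂ-Solver

    -- P₁ is b x + c with b and c real, so the imaginary part of its value is b times that of x; one
    -- more factor b makes it positive for either sign of β.
    stable₁ : StronglyStable lift₁
    stable₁ = stable , λ { [] _ → b≄0 }
      where
      stable : Stable lift₁
      stable ((u , v) ∷ []) (0<uv ∷ []) value≃0 = pos⇒≄0 (pos*pos 0<b² 0<uv) (begin
        ⊖ β ⊗ ⊖ β ⊗ cross u v
          ≈⟨ ⊗-assoc (⊖ β) (⊖ β) (cross u v) ⟩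
        ⊖ β ⊗ (⊖ β ⊗ cross u v)
          ≈⟨ ⊗-zeroʳ (⊖ β) (≃-trans (≃-sym cross-value)
               (cross-zeroˡ v (ℂᵣ.trans (ℂᵣ.sym value) value≃0))) ⟩
        0ℝ ∎)
        where
        open ≃-Reasoning
        value : eval lift₁ ((u , v) ∷ []) ≃ℂ b ⊠ u ⊞ c ⊠ v
        value = solve 4 (λ u v b c →
          v :* (c :* con 1ℚ) :+ u :* (b :* (con 1ℚ :+ con 0ℚ)) := b :* u :+ c :* v) ℂᵣ.refl u v b c
          where open ℂ-Solver
        cross-value : cross (b ⊠ u ⊞ c ⊠ v) v ≃ ⊖ β ⊗ cross u v
        cross-value = cross-affine (⊖ β) (slope α 0) u v

    stableLift₁ : StableLift 0
    stableLift₁ = lift₁ , stable₁ , lifts₁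

isReal-⊞ : ∀ {x y r s} → x ≃ℂ ofReal r → y ≃ℂ ofReal s → x ⊞ y ≃ℂ ofReal (r ⊕ s)
isReal-⊞ {r = r} {s} p q = ℂᵣ.trans (⊞-cong p q) (ℂᵣ.sym (ofReal-⊕ r s))

isReal-⊠ : ∀ {x y r s} → x ≃ℂ ofReal r → y ≃ℂ ofReal s → x ⊠ y ≃ℂ ofReal (r ⊗ s)
isReal-⊠ {r = r} {s} p q = ℂᵣ.trans (⊠-cong p q) (ℂᵣ.sym (ofReal-⊗ r s))

-- The lift of P₂ and its discriminant

module _ (α β : ℝ) where
  private
    -- By the recurrence P₂ = b² x² + b (1 - 2 α + b) x + α (α - 1). So `p` is its constant term,
    -- `h` comes from completing the square, and the discriminant is 4 b² D.
    b h p D : ℝ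
    b = ⊖ β
    h = fromℚ ½ ⊗ (1ℝ ⊕ ⊖ (fromℕ 2 ⊗ α) ⊕ b)
    p = α ⊗ (α ⊕ ⊖ 1ℝ)
    D = h ⊗ h ⊕ ⊖ p

  -- The symmetric polarisation of P₂ = (b x + h)² - D.
  lift₂ : MultiAffine 2
  lift₂ = (const (ofReal p) +x· const (ofReal (b ⊗ h)))
     +x· (const (ofReal (b ⊗ h)) +x· const (ofReal (b ⊗ b)))

  -- Applying `step` to `lift₁` gives another, in general asymmetric lift of P₂. Its stability is
  -- not claimed; it only supplies the diagonal with which the symmetric one is compared.
  lifts₂ : Lifts α β lift₂
  lifts₂ k = ℂᵣ.trans (agree k) (step-lifts α β (lift₁ α β) (lifts₁ α β) k)
    where
    open ℝ-Solver
    c₀ = slope α 0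
    c₁ = slope α 1
    L = lift₁ α β

    L₀ : coeff L 0 ≃ℂ ofReal (c₀ ⊗ 1ℝ)
    L₀ = isReal-⊠ {ofReal c₀} {1ℂ} ℂᵣ.refl ℂᵣ.refl
    L₁ : coeff L 1 ≃ℂ ofReal (0ℝ ⊕ b ⊗ (1ℝ ⊕ 0ℝ))
    L₁ = isReal-⊞ {0ℂ} ℂᵣ.refl (isReal-⊠ {ofReal b} ℂᵣ.refl (isReal-⊞ {1ℂ} {0ℂ} ℂᵣ.refl ℂᵣ.refl))
    L₂ : coeff L 2 ≃ℂ ofReal 0ℝ
    L₂ = coeff-vanish L 2 (s≤s (s≤s z≤n))

    agree : ∀ k → coeff lift₂ k ≃ℂ coeff (step c₁ b L) k
    agree 0 = ℂᵣ.trans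
      (ofReal-cong (solve 1 (λ α → α :* (α :+ :- con 1ℚ) :=
        (con 1ℚ :+ :- α) :* ((con 0ℚ :+ :- α) :* con 1ℚ)) ≃-refl α))
      (ℂᵣ.sym (isReal-⊠ {ofReal c₁} ℂᵣ.refl L₀))
    agree 1 = ℂᵣ.trans (isReal-⊞ (isReal-⊞ {0ℂ} ℂᵣ.refl (ℂᵣ.refl {ofReal (b ⊗ h)})) (ℂᵣ.refl {ofReal (b ⊗ h)}))
      (ℂᵣ.trans
        (ofReal-cong (solve 2 (λ α b →
          let q = b :* (con ½ :* (con 1ℚ :+ :- (con (+ 2 ℚ./ 1) :* α) :+ b)) in
          (con 0ℚ :+ q) :+ q :=
          (con 1ℚ :+ :- α) :* (con 0ℚ :+ b :* (con 1ℚ :+ con 0ℚ)) :+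
            b :* ((con 0ℚ :+ :- α) :* con 1ℚ :+ con 1ℚ :* (con 0ℚ :+ b :* (con 1ℚ :+ con 0ℚ))))
          ≃-refl α b))
        (ℂᵣ.sym (ℂᵣ.trans (coeff-step-suc c₁ b L 0)
          (isReal-⊞ (isReal-⊠ {ofReal c₁} ℂᵣ.refl L₁)
            (isReal-⊠ {ofReal b} ℂᵣ.refl (isReal-⊞ L₀ (isReal-⊠ {natℂ 1} ℂᵣ.refl L₁)))))))
    agree 2 = ℂᵣ.trans
      (isReal-⊞ (isReal-⊞ {0ℂ} {0ℂ} ℂᵣ.refl ℂᵣ.refl) (isReal-⊞ {0ℂ} ℂᵣ.refl (ℂᵣ.refl {ofReal (b ⊗ b)})))
      (ℂᵣ.trans
        (ofReal-cong (solve 3 (λ c b m →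
          (con 0ℚ :+ con 0ℚ) :+ (con 0ℚ :+ b :* b) :=
          c :* con 0ℚ :+ b :* ((con 0ℚ :+ b :* (con 1ℚ :+ con 0ℚ)) :+ m :* con 0ℚ))
          ≃-refl c₁ b (fromℕ 2)))
        (ℂᵣ.sym (ℂᵣ.trans (coeff-step-suc c₁ b L 1)
          (isReal-⊞ (isReal-⊠ {ofReal c₁} ℂᵣ.refl L₂)
            (isReal-⊠ {ofReal b} ℂᵣ.refl (isReal-⊞ L₁ (isReal-⊠ {natℂ 2} ℂᵣ.refl L₂)))))))
    agree (suc (suc (suc k))) = ℂᵣ.trans (coeff-vanish lift₂ (suc (suc (suc k))) 2<k)
      (ℂᵣ.sym (coeff-vanish (step c₁ b L) (suc (suc (suc k))) 2<k))
      where
      2<k : 2 ℕ.< suc (suc (suc k))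
      2<k = s≤s (s≤s (s≤s z≤n))

  -- If U V = D v₁ v₂ with U = b u₁ + h v₁ and V = b u₂ + h v₂, then
  -- |U|² Im (V v̄₂) + D |v₂|² Im (U v̄₁) = 0, a sum of a positive and a nonnegative number.
  stable₂ : 0ℝ <ℝ b → 0ℝ ≤ℝ D → StronglyStable lift₂
  stable₂ 0<b 0≤D = stable , stable-top
    where
    stable : Stable lift₂
    stable ((u₁ , v₁) ∷ (u₂ , v₂) ∷ []) (0<u₁v₁ ∷ 0<u₂v₂ ∷ []) value≃0 =
      normSq-¬¬pos (λ U≃0 → pos⇒≄0 0<Uv₁ (cross-zeroˡ v₁ U≃0)) λ 0<∣U∣² →
      pos⇒≄0 (pos+nonNeg (pos*pos 0<∣U∣² 0<Vv₂)
               (nonNeg*nonNeg 0≤D (nonNeg*nonNeg (normSq-nonNeg v₂) (pos⇒nonNeg 0<Uv₁))))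
        (≃-trans (≃-sym cross-value)
          (cross-zeroˡ (U ⊠ v₂) (ℂᵣ.trans (ℂᵣ.sym value) value≃0)))
      where
      open ≃-Reasoning
      U V : ℂ
      U = ofReal b ⊠ u₁ ⊞ ofReal h ⊠ v₁
      V = ofReal b ⊠ u₂ ⊞ ofReal h ⊠ v₂

      0<Uv₁ : 0ℝ <ℝ cross U v₁
      0<Uv₁ = pos-resp-≃ (≃-sym (cross-affine b h u₁ v₁)) (pos*pos 0<b 0<u₁v₁)
      0<Vv₂ : 0ℝ <ℝ cross V v₂
      0<Vv₂ = pos-resp-≃ (≃-sym (cross-affine b h u₂ v₂)) (pos*pos 0<b 0<u₂v₂)

      value : eval lift₂ ((u₁ , v₁) ∷ (u₂ , v₂) ∷ []) ≃ℂ U ⊠ V ⊞ ofReal D ⊠ (⊟ v₁ ⊠ v₂)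
      value = ℂᵣ.trans
        (ℂᵣ.+-cong (ℂᵣ.*-congˡ {v₁} (ℂᵣ.+-congˡ {v₂ ⊠ ofReal p} (ℂᵣ.*-congˡ {u₂} (ofReal-⊗ b h))))
          (ℂᵣ.*-congˡ {u₁} (ℂᵣ.+-cong (ℂᵣ.*-congˡ {v₂} (ofReal-⊗ b h)) (ℂᵣ.*-congˡ {u₂} (ofReal-⊗ b b)))))
        (ℂᵣ.trans
          (expand (ofReal b) (ofReal h) (ofReal p) u₁ v₁ u₂ v₂)
          (ℂᵣ.+-congˡ {U ⊠ V} (ℂᵣ.*-congʳ {⊟ v₁ ⊠ v₂} (ℂᵣ.sym
            (ℂᵣ.trans (ofReal-⊕ (h ⊗ h) (⊖ p)) (⊞-cong (ofReal-⊗ h h) (ofReal-⊖ p)))))))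
        where
        expand : ∀ b h p u₁ v₁ u₂ v₂ →
          v₁ ⊠ (v₂ ⊠ p ⊞ u₂ ⊠ (b ⊠ h)) ⊞ u₁ ⊠ (v₂ ⊠ (b ⊠ h) ⊞ u₂ ⊠ (b ⊠ b)) ≃ℂ
          (b ⊠ u₁ ⊞ h ⊠ v₁) ⊠ (b ⊠ u₂ ⊞ h ⊠ v₂) ⊞ (h ⊠ h ⊞ ⊟ p) ⊠ (⊟ v₁ ⊠ v₂)
        expand = solve 7 (λ b h p u₁ v₁ u₂ v₂ →
          v₁ :* (v₂ :* p :+ u₂ :* (b :* h)) :+ u₁ :* (v₂ :* (b :* h) :+ u₂ :* (b :* b)) :=
          (b :* u₁ :+ h :* v₁) :* (b :* u₂ :+ h :* v₂) :+ (h :* h :+ :- p) :* (:- v₁ :* v₂)) ℂᵣ.refl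
          where open ℂ-Solver

      cross-value : cross (U ⊠ V ⊞ ofReal D ⊠ (⊟ v₁ ⊠ v₂)) (U ⊠ v₂) ≃
                    normSq U ⊗ cross V v₂ ⊕ D ⊗ (normSq v₂ ⊗ cross U v₁)
      cross-value = begin
        cross (U ⊠ V ⊞ ofReal D ⊠ (⊟ v₁ ⊠ v₂)) (U ⊠ v₂)
          ≈⟨ cross-⊞ˡ (U ⊠ V) (ofReal D ⊠ (⊟ v₁ ⊠ v₂)) (U ⊠ v₂) ⟩
        cross (U ⊠ V) (U ⊠ v₂) ⊕ cross (ofReal D ⊠ (⊟ v₁ ⊠ v₂)) (U ⊠ v₂)
          ≈⟨ ⊕-cong (cross-⊠ˡ U V v₂) (≃-trans (cross-ofReal D (⊟ v₁ ⊠ v₂) (U ⊠ v₂))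
               (⊗-cong ≃-refl (≃-trans (cross-⊠ʳ (⊟ v₁) U v₂)
                 (⊗-cong ≃-refl (≃-sym (cross-⊟-swap U v₁)))))) ⟩
        normSq U ⊗ cross V v₂ ⊕ D ⊗ (normSq v₂ ⊗ cross U v₁) ∎

    -- The leading coefficient b h + b² x is again linear with real coefficients and b² > 0.
    stable-top : Stable (const (ofReal (b ⊗ h)) +x· const (ofReal (b ⊗ b)))
    stable-top ((u , v) ∷ []) (0<uv ∷ []) value≃0 = pos⇒≄0 (pos*pos (pos*pos 0<b 0<b) 0<uv)
      (≃-trans (≃-sym (cross-affine (b ⊗ b) (b ⊗ h) u v)) (cross-zeroˡ v (ℂᵣ.trans
        (solve 4 (λ u v r q → r :* u :+ q :* v := v :* q :+ u :* r) ℂᵣ.refl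
          u v (ofReal (b ⊗ b)) (ofReal (b ⊗ h))) value≃0)))
      where open ℂ-Solver

  stableLift₂ : 0ℝ <ℝ b → 0ℝ ≤ℝ D → StableLift α β 1
  stableLift₂ 0<b 0≤D = lift₂ , stable₂ 0<b 0≤D , lifts₂

  -- The terms 4 α² cancel in 4 D = (1 - 2 α - β)² - 4 α (α - 1), which leaves (β - 1)² + 4 α β.
  discriminant⇒nonNeg : 0ℝ ≤ℝ (β -ℝ 1ℝ) *ℝ (β -ℝ 1ℝ) +ℝ fromℕ 4 *ℝ α *ℝ β → 0ℝ ≤ℝ D
  discriminant⇒nonNeg 0≤Δ = nonNeg-resp-≃
    (solve 2 (λ α β → con (+ 1 ℚ./ 4) :*
        ((β :+ :- con 1ℚ) :* (β :+ :- con 1ℚ) :+ con (+ 4 ℚ./ 1) :* α :* β) :=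
      con ½ :* (con 1ℚ :+ :- (con (+ 2 ℚ./ 1) :* α) :+ :- β)
        :* (con ½ :* (con 1ℚ :+ :- (con (+ 2 ℚ./ 1) :* α) :+ :- β))
        :+ :- (α :* (α :+ :- con 1ℚ))) ≃-refl α β)
    (nonNeg*nonNeg (fromℚ-nonNeg (ℚₚ.nonNegative⁻¹ (+ 1 ℚ./ 4)))
      (subst (0ℝ ≤ℝ_) convert 0≤Δ))
    where
    open ℝ-Solver
    convert : (β -ℝ 1ℝ) *ℝ (β -ℝ 1ℝ) +ℝ fromℕ 4 *ℝ α *ℝ β ≡
              (β ⊕ ⊖ 1ℝ) ⊗ (β ⊕ ⊖ 1ℝ) ⊕ fromℕ 4 ⊗ α ⊗ β
    convert = trans (+ℝ≡⊕ ((β -ℝ 1ℝ) *ℝ (β -ℝ 1ℝ)) (fromℕ 4 *ℝ α *ℝ β)) (cong₂ _⊕_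
      (trans (*ℝ≡⊗ (β -ℝ 1ℝ) (β -ℝ 1ℝ)) (cong (λ x → x ⊗ x) (x-ℝy≡x⊕⊖y β 1ℝ)))
      (trans (*ℝ≡⊗ (fromℕ 4 *ℝ α) β) (cong (_⊗ β) (*ℝ≡⊗ (fromℕ 4) α))))

-- The two parameter ranges

slope-suc : ∀ α n → 1ℝ ⊕ slope α n ≃ slope α (suc n)
slope-suc α n = ≃-trans (≃-sym (⊕-assoc 1ℝ (fromℕ n) (⊖ α)))
  (⊕-cong (≃-sym (fromℕ-suc n)) ≃-refl)

A⇒stableLift : ∀ α β → A α β → ∀ m → StableLift α β m
A⇒stableLift α β (0≤Δ , β<0 , α≤2) = go
  where
  0<b : 0ℝ <ℝ ⊖ β
  0<b = neg⇒pos β<0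

  slope-nonNeg : ∀ m → 0ℝ ≤ℝ slope α (2 ℕ.+ m)
  slope-nonNeg zero    = ≤⇒nonNeg α≤2
  slope-nonNeg (suc m) = nonNeg-resp-≃ (slope-suc α (2 ℕ.+ m))
    (nonNeg+nonNeg (pos⇒nonNeg 0<1) (slope-nonNeg m))

  go : ∀ m → StableLift α β m
  go zero          = stableLift₁ α β (pos*pos 0<b 0<b)
  -- A step from P₁ would have c = 1 - α, which is negative for 1 < α ≤ 2; the discriminant
  -- condition takes over here, and from P₂ on α ≤ 2 suffices.
  go (suc zero)    = stableLift₂ α β 0<b (discriminant⇒nonNeg α β 0≤Δ)
  go (suc (suc m)) = stableLift-suc α β (pos*pos 0<b 0<b)
    (nonNeg*nonNeg (slope-nonNeg m) (pos⇒nonNeg 0<b)) (go (suc m))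

Ã⇒stableLift : ∀ α β → Ã α β → ∀ ⌈α⌉ → IsCeiling α ⌈α⌉ →
  ∀ m → + suc m ℤ.≤ ⌈α⌉ → StableLift α β m
Ã⇒stableLift α β (0<β , _) ⌈α⌉ (_ , least) = go
  where
  0<b² : 0ℝ <ℝ ⊖ β ⊗ ⊖ β
  0<b² = pos-resp-≃ (solve 1 (λ β → β :* β := :- β :* :- β) ≃-refl β) (pos*pos 0<β 0<β)
    where open ℝ-Solver

  -- If α were below n, then n would be an integer upper bound of α and the ceiling at most n,
  -- against n + 1 ≤ ⌈α⌉.
  below-ceiling : ∀ n → + suc n ℤ.≤ ⌈α⌉ → 0ℝ ≤ℝ α ⊕ ⊖ fromℕ n
  below-ceiling n n<⌈α⌉ = ¬neg⇒nonNeg λ 0<n-α →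
    ℕₚ.<-irrefl refl (ℤₚ.drop‿+≤+ (ℤₚ.≤-trans n<⌈α⌉ (least (+ n) (nonNeg⇒≤ (pos⇒nonNeg
      (pos-resp-≃ (solve 2 (λ α n → :- (α :+ :- n) := n :+ :- α) ≃-refl α (fromℕ n)) 0<n-α))))))
    where open ℝ-Solver

  go : ∀ m → + suc m ℤ.≤ ⌈α⌉ → StableLift α β m
  go zero    _     = stableLift₁ α β 0<b²
  -- The step to index m + 2 has c = m + 1 - α, and c b = (α - (m + 1)) β with β > 0; the bound m +
  -- 2 ≤ ⌈α⌉ is exactly what `below-ceiling` asks for at m + 1.
  go (suc m) m<⌈α⌉ = stableLift-suc α β 0<b²
    (nonNeg-resp-≃
      (solve 3 (λ α β n → (α :+ :- n) :* β := (n :+ :- α) :* :- β) ≃-refl α β (fromℕ (suc m)))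
      (nonNeg*nonNeg (below-ceiling (suc m) m<⌈α⌉) (pos⇒nonNeg 0<β)))
    (go m (ℤₚ.≤-trans (ℤ.+≤+ (ℕₚ.n≤1+n (suc m))) m<⌈α⌉))
    where open ℝ-Solver

theorem3 : (∀ (α β : ℝ) → A α β → ∀ (n : ℕ) → 1 ℕ.≤ n → HasOnlyRealZeros (P α β n))
    × (∀ (α β : ℝ) → Ã α β → ∀ (⌈α⌉ : ℤ) → IsCeiling α ⌈α⌉ →
    ∀ (n : ℕ) → 1 ℕ.≤ n → + n ℤ.≤ ⌈α⌉ → HasOnlyRealZeros (P α β n))
theorem3 =
  (λ { α β αβ∈A (suc m) _ → stableLift⇒onlyRealZeros α β (A⇒stableLift α β αβ∈A m) }) ,
  (λ { α β αβ∈Ã ⌈α⌉ isCeiling (suc m) _ n≤⌈α⌉ →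
    stableLift⇒onlyRealZeros α β (Ã⇒stableLift α β αβ∈Ã ⌈α⌉ isCeiling m n≤⌈α⌉) })
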